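{- $\mathbf{JID_1}=\mathbf{DSt}\vee\mathbf{V(D_1,D_2,D_3)}$, where the join is taken in the lattice of subvarieties of $\mathbf{DQD}$ and $\mathbf{V(D_1,D_2,D_3)}$ is the variety generated by $\{\mathbf{D_1},\mathbf{D_2},\mathbf{D_3}\}$.
   Context: A semi-Heyting algebra is an algebra $\langle L,\vee,\wedge,\to,0,1\rangle$ such that $\langle L,\vee,\wedge,0,1\rangle$ is a bounded lattice and the identities $x\wedge(x\to y)\approx x\wedge y$, $x\wedge(y\to z)\approx x\wedge[(x\wedge y)\to(x\wedge z)]$, $x\to x\approx 1$ hold; write $x^*:=x\to 0$. A $\mathbf{DQD}$-algebra (dually quasi-De Morgan semi-Heyting algebra) is an algebra $\langle L,\vee,\wedge,\to,{}',0,1\rangle$ whose reduct $\langle L,\vee,\wedge,\to,0,1\rangle$ is a semi-Heyting algebra and which satisfies: $0'\approx 1$ and $1'\approx 0$; $(x\wedge y)'\approx x'\vee y'$; $(x\vee y)''\approx x''\vee y''$; $x''\le x$. $\mathbf{DQD}$ denotes the variety of all $\mathbf{DQD}$-algebras. $\mathbf{DSt}$ is the subvariety of $\mathbf{DQD}$ defined by $x'\wedge x''\approx 0$. $\mathbf{JID}$ is the subvariety of $\mathbf{DQD}$ defined by $x'\vee(y\to z)\approx(x'\vee y)\to(x'\vee z)$, and $\mathbf{JID_1}$ is the subvariety of $\mathbf{JID}$ defined by $x\wedge x'^{*}\approx (x\wedge x'^{*})'^{*}$ (where $z'^*$ means $(z')^*$); relative to $\mathbf{JID}$ this is equivalent to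 the level-1 identity $x\wedge x'^*\approx x\wedge x'^*\wedge x'^*{}'^*$. The algebras $\mathbf{D_1},\mathbf{D_2},\mathbf{D_3}$ all have universe $\{0,a,b,1\}$ with the four-element Boolean lattice order ($a,b$ complementary atoms), and $0'=1$, $1'=0$, $a'=a$, $b'=b$. The operation $\to$ is given by listing, for each $x$, the tuple $(x\to 0,\ x\to 1,\ x\to a,\ x\to b)$. In $\mathbf{D_1}$: $x=0$: $(1,0,b,a)$; $x=1$: $(0,1,a,b)$; $x=a$: $(b,a,1,0)$; $x=b$: $(a,b,0,1)$. In $\mathbf{D_2}$: $x=0$: $(1,1,1,1)$; $x=1$: $(0,1,a,b)$; $x=a$: $(b,1,1,b)$; $x=b$: $(a,1,a,1)$. In $\mathbf{D_3}$: $x=0$: $(1,a,1,a)$; $x=1$: $(0,1,a,b)$; $x=a$: $(b,a,1,0)$; $x=b$: $(a,1,a,1)$. -}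

module Defs where

open import Algebra.Core using (Op₁; Op₂)
import Algebra.Definitions as AlgDefs
open import Algebra.Lattice.Structures using (IsLattice)
open import Data.List using (List; []; _∷_)
open import Data.List.Membership.Propositional using (_∈_)
open import Data.List.Relation.Unary.All as All using (All)
open import Data.Nat using (ℕ)
open import Data.Product using (_×_; _,_; proj₁; proj₂)
open import Data.Sum using (_⊎_; inj₁; inj₂)
open import Level using (Level; Lift; lift; lower; 0ℓ; _⊔_) renaming (suc to lsuc)
open import Relation.Binary.Core using (Rel)
open import Relation.Binary.Definitions using (DecidableEquality)
open import Relation.Binary.Lattice using (Lattice)
open import Relation.Binary.PropositionalEquality using (_≡_; refl; cong; cong₂; isEquivalence)
open import Relation.Nullary using (Dec; yes; no)
open import Relation.Nullary.Decidable using (from-yes)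
open import Relation.Unary using (Pred; Decidable)

------------------------------------------------------------------------
-- Semi-Heyting algebras and DQD-algebras

module _ {c ℓ} {A : Set c} (_≈_ : Rel A ℓ) where

  open AlgDefs _≈_

  record IsSemiHeyting (_∨_ _∧_ _⇒_ : Op₂ A) (𝟎 𝟏 : A) : Set (c ⊔ ℓ) where
    field
      isLattice    : IsLattice _≈_ _∨_ _∧_
      ∨-identityˡ  : LeftIdentity 𝟎 _∨_
      ∧-identityˡ  : LeftIdentity 𝟏 _∧_
      ⇒-cong       : Congruent₂ _⇒_
      ∧-⇒          : ∀ x y → (x ∧ (x ⇒ y)) ≈ (x ∧ y)
      ∧-⇒-relative : ∀ x y z → (x ∧ (y ⇒ z)) ≈ (x ∧ ((x ∧ y) ⇒ (x ∧ z)))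
      ⇒-refl       : ∀ x → (x ⇒ x) ≈ 𝟏

    open IsLattice isLattice public

  record IsDQD (_∨_ _∧_ _⇒_ : Op₂ A) (_′ : Op₁ A) (𝟎 𝟏 : A) : Set (c ⊔ ℓ) where
    field
      isSemiHeyting : IsSemiHeyting _∨_ _∧_ _⇒_ 𝟎 𝟏
      ′-cong        : Congruent₁ _′
      𝟎′            : (𝟎 ′) ≈ 𝟏
      𝟏′            : (𝟏 ′) ≈ 𝟎
      ∧-′           : ∀ x y → ((x ∧ y) ′) ≈ ((x ′) ∨ (y ′))
      ∨-′′          : ∀ x y → (((x ∨ y) ′) ′) ≈ (((x ′) ′) ∨ ((y ′) ′))
      -- x ′′ ≤ x in the lattice order
      ′′-≤          : ∀ x → (((x ′) ′) ∧ x) ≈ ((x ′) ′)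

    open IsSemiHeyting isSemiHeyting public

record DQDAlgebra (c ℓ : Level) : Set (lsuc (c ⊔ ℓ)) where
  infix  4 _≈_
  infixr 5 _⇒_
  infixr 6 _∨_
  infixr 7 _∧_
  infixl 9 _′
  field
    Carrier     : Set c
    _≈_         : Rel Carrier ℓ
    _∨_ _∧_ _⇒_ : Op₂ Carrier
    _′          : Op₁ Carrier
    𝟎 𝟏         : Carrier
    isDQD       : IsDQD _≈_ _∨_ _∧_ _⇒_ _′ 𝟎 𝟏

  open IsDQD isDQD public

------------------------------------------------------------------------
-- Terms and identities in the language ⟨∨, ∧, →, ′, 0, 1⟩

infix  4 _:≈_
infixr 5 _:→_
infixr 6 _:∨_
infixr 7 _:∧_
infixl 9 _:′ _:*

data Term : Set where
  var              : ℕ → Term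
  _:∨_ _:∧_ _:→_   : Term → Term → Term
  _:′              : Term → Term
  :0 :1            : Term

_:* : Term → Term
t :* = t :→ :0

record Identity : Set where
  constructor _:≈_
  field
    lhs rhs : Term

module _ {c ℓ} (𝐀 : DQDAlgebra c ℓ) where

  open DQDAlgebra 𝐀

  ⟦_⟧ : Term → (ℕ → Carrier) → Carrier
  ⟦ var n ⟧  ρ = ρ n
  ⟦ s :∨ t ⟧ ρ = ⟦ s ⟧ ρ ∨ ⟦ t ⟧ ρ
  ⟦ s :∧ t ⟧ ρ = ⟦ s ⟧ ρ ∧ ⟦ t ⟧ ρ
  ⟦ s :→ t ⟧ ρ = ⟦ s ⟧ ρ ⇒ ⟦ t ⟧ ρ
  ⟦ t :′ ⟧   ρ = ⟦ t ⟧ ρ ′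
  ⟦ :0 ⟧     ρ = 𝟎
  ⟦ :1 ⟧     ρ = 𝟏

  infix 4 _⊨_
  _⊨_ : Identity → Set (c ⊔ ℓ)
  _⊨_ (s :≈ t) = ∀ ρ → ⟦ s ⟧ ρ ≈ ⟦ t ⟧ ρ

------------------------------------------------------------------------
-- Subvarieties of DQD

-- A subvariety is an equational class of DQD-algebras.  It is presented by
-- some set of identities; two presentations are identified (in the lattice
-- below) when they have the same models among the DQD-algebras of the given
-- universe levels.

record Subvariety (c ℓ : Level) : Set (lsuc (lsuc (c ⊔ ℓ))) where
  constructor Mod
  field
    axioms : Pred Identity (lsuc (c ⊔ ℓ))

open Subvariety public

module _ {c ℓ : Level} where

  infix 4 _∈ᵛ_ _⊆ᵛ_ _≐ᵛ_
  infixr 6 _∨ᵛ_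
  infixr 7 _∧ᵛ_

  _∈ᵛ_ : ∀ {a b} → DQDAlgebra a b → Subvariety c ℓ → Set (a ⊔ b ⊔ lsuc (c ⊔ ℓ))
  𝐀 ∈ᵛ 𝒱 = ∀ e → axioms 𝒱 e → 𝐀 ⊨ e

  _⊆ᵛ_ : Rel (Subvariety c ℓ) (lsuc (c ⊔ ℓ))
  𝒱 ⊆ᵛ 𝒲 = (𝐀 : DQDAlgebra c ℓ) → 𝐀 ∈ᵛ 𝒱 → 𝐀 ∈ᵛ 𝒲

  _≐ᵛ_ : Rel (Subvariety c ℓ) (lsuc (c ⊔ ℓ))
  𝒱 ≐ᵛ 𝒲 = 𝒱 ⊆ᵛ 𝒲 × 𝒲 ⊆ᵛ 𝒱

  -- The identities valid throughout a subvariety.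
  Th : Subvariety c ℓ → Pred Identity (lsuc (c ⊔ ℓ))
  Th 𝒱 e = (𝐀 : DQDAlgebra c ℓ) → 𝐀 ∈ᵛ 𝒱 → 𝐀 ⊨ e

  _∨ᵛ_ : Op₂ (Subvariety c ℓ)
  𝒱 ∨ᵛ 𝒲 = Mod λ e → Th 𝒱 e × Th 𝒲 e

  _∧ᵛ_ : Op₂ (Subvariety c ℓ)
  𝒱 ∧ᵛ 𝒲 = Mod λ e → axioms 𝒱 e ⊎ axioms 𝒲 e

subvarieties : ∀ c ℓ → Lattice (lsuc (lsuc (c ⊔ ℓ))) (lsuc (c ⊔ ℓ)) (lsuc (c ⊔ ℓ))
subvarieties c ℓ = record
  { Carrier   = Subvariety c ℓ
  ; _≈_       = _≐ᵛ_
  ; _≤_       = _⊆ᵛ_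
  ; _∨_       = _∨ᵛ_
  ; _∧_       = _∧ᵛ_
  ; isLattice = record
    { isPartialOrder = record
      { isPreorder = record
        { isEquivalence = record
          { refl  = (λ _ m → m) , (λ _ m → m)
          ; sym   = λ (p , q) → q , p
          ; trans = λ (p , q) (r , s) → (λ 𝐀 m → r 𝐀 (p 𝐀 m)) , (λ 𝐀 m → q 𝐀 (s 𝐀 m))
          }
        ; reflexive = proj₁
        ; trans     = λ p q 𝐀 m → q 𝐀 (p 𝐀 m)
        }
      ; antisym = _,_
      }
    ; supremum = λ 𝒱 𝒲 →
        (λ 𝐀 m e (v , _) → v 𝐀 m)
      , (λ 𝐀 m e (_ , w) → w 𝐀 m)
      , (λ 𝒰 p q 𝐀 m e u → m e ((λ 𝐁 n → p 𝐁 n e u) , (λ 𝐁 n → q 𝐁 n e u)))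
    ; infimum = λ 𝒱 𝒲 →
        (λ 𝐀 m e v → m e (inj₁ v))
      , (λ 𝐀 m e w → m e (inj₂ w))
      , (λ { 𝒰 p q 𝐀 m e (inj₁ v) → p 𝐀 m e v
           ; 𝒰 p q 𝐀 m e (inj₂ w) → q 𝐀 m e w })
    }
  }

module _ {c ℓ : Level} where

  definedBy : List Identity → Subvariety c ℓ
  definedBy es = Mod λ e → Lift (lsuc (c ⊔ ℓ)) (e ∈ es)

  -- The variety generated by 𝐀₁, …, 𝐀ₙ: the models of all identities valid
  -- in every 𝐀ᵢ.  The generators may live in a smaller universe than its
  -- members, so minimality is stated with _∈ᵛ_ at level 0.
  V : List (DQDAlgebra 0ℓ 0ℓ) → Subvariety c ℓ
  V 𝐀s = Mod λ e → Lift (lsuc (c ⊔ ℓ)) (All (_⊨ e) 𝐀s)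

  V-contains : ∀ 𝐀s → All (_∈ᵛ V 𝐀s) 𝐀s
  V-contains 𝐀s = All.tabulate λ i e v → All.lookup (lower v) i

  V-least : ∀ 𝐀s (𝒲 : Subvariety c ℓ) → All (_∈ᵛ 𝒲) 𝐀s → V 𝐀s ⊆ᵛ 𝒲
  V-least 𝐀s 𝒲 ms 𝐁 b e w = b e (lift (All.map (λ m → m e w) ms))

------------------------------------------------------------------------
-- The subvarieties DSt, JID and JID₁

private
  x y z : Term
  x = var 0
  y = var 1
  z = var 2

dualStone : Identity
dualStone = x :′ :∧ x :′ :′ :≈ :0

joinInfDistr : Identity
joinInfDistr = x :′ :∨ (y :→ z) :≈ (x :′ :∨ y) :→ (x :′ :∨ z)

level1 : Identity
level1 = x :∧ x :′ :* :≈ (x :∧ x :′ :*) :′ :*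

module _ {c ℓ : Level} where

  DSt JID JID₁ : Subvariety c ℓ
  DSt  = definedBy (dualStone ∷ [])
  JID  = definedBy (joinInfDistr ∷ [])
  JID₁ = JID ∧ᵛ definedBy (level1 ∷ [])

------------------------------------------------------------------------
-- The four-element algebras D₁, D₂, D₃

data Four : Set where
  o a b i : Four          -- o = 0, i = 1

infix 4 _≟_
_≟_ : DecidableEquality Four
o ≟ o = yes refl
o ≟ a = no λ ()
o ≟ b = no λ ()
o ≟ i = no λ ()
a ≟ o = no λ ()
a ≟ a = yes refl
a ≟ b = no λ ()
a ≟ i = no λ ()
b ≟ o = no λ ()
b ≟ a = no λ ()
b ≟ b = yes refl
b ≟ i = no λ ()
i ≟ o = no λ ()
i ≟ a = no λ ()
i ≟ b = no λ ()
i ≟ i = yes refl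

∀? : ∀ {p} {P : Pred Four p} → Decidable P → Dec (∀ u → P u)
∀? P? with P? o | P? a | P? b | P? i
... | yes po | yes pa | yes pb | yes pi = yes λ { o → po ; a → pa ; b → pb ; i → pi }
... | no ¬p  | _      | _      | _      = no λ f → ¬p (f o)
... | _      | no ¬p  | _      | _      = no λ f → ¬p (f a)
... | _      | _      | no ¬p  | _      = no λ f → ¬p (f b)
... | _      | _      | _      | no ¬p  = no λ f → ¬p (f i)

infixr 6 _∨₄_
infixr 7 _∧₄_
infixl 9 _′₄

_∨₄_ : Op₂ Four
o ∨₄ v = v
i ∨₄ v = i
a ∨₄ o = a
a ∨₄ a = a
a ∨₄ b = i
a ∨₄ i = i
b ∨₄ o = b
b ∨₄ a = i
b ∨₄ b = b
b ∨₄ i = i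

_∧₄_ : Op₂ Four
o ∧₄ v = o
i ∧₄ v = v
a ∧₄ o = o
a ∧₄ a = a
a ∧₄ b = o
a ∧₄ i = a
b ∧₄ o = o
b ∧₄ a = o
b ∧₄ b = b
b ∧₄ i = b

_′₄ : Op₁ Four
o ′₄ = i
a ′₄ = a
b ′₄ = b
i ′₄ = o

-- row p q r s is the function with values p, q, r, s at 0, 1, a, b
-- (in this order).
row : Four → Four → Four → Four → Op₁ Four
row p q r s o = p
row p q r s i = q
row p q r s a = r
row p q r s b = s

_⇒₁_ _⇒₂_ _⇒₃_ : Op₂ Four

o ⇒₁ v = row i o b a v
i ⇒₁ v = row o i a b v
a ⇒₁ v = row b a i o v
b ⇒₁ v = row a b o i v

o ⇒₂ v = row i i i i v
i ⇒₂ v = row o i a b v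
a ⇒₂ v = row b i i b v
b ⇒₂ v = row a i a i v

o ⇒₃ v = row i a i a v
i ⇒₃ v = row o i a b v
a ⇒₃ v = row b a i o v
b ⇒₃ v = row a i a i v

∨₄-∧₄-isLattice : IsLattice _≡_ _∨₄_ _∧₄_
∨₄-∧₄-isLattice = record
  { isEquivalence = isEquivalence
  ; ∨-comm        = from-yes (∀? λ u → ∀? λ v → u ∨₄ v ≟ v ∨₄ u)
  ; ∨-assoc       = from-yes (∀? λ u → ∀? λ v → ∀? λ w → (u ∨₄ v) ∨₄ w ≟ u ∨₄ v ∨₄ w)
  ; ∨-cong        = cong₂ _∨₄_
  ; ∧-comm        = from-yes (∀? λ u → ∀? λ v → u ∧₄ v ≟ v ∧₄ u)
  ; ∧-assoc       = from-yes (∀? λ u → ∀? λ v → ∀? λ w → (u ∧₄ v) ∧₄ w ≟ u ∧₄ v ∧₄ w)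
  ; ∧-cong        = cong₂ _∧₄_
  ; absorptive    = from-yes (∀? λ u → ∀? λ v → u ∨₄ (u ∧₄ v) ≟ u)
                  , from-yes (∀? λ u → ∀? λ v → u ∧₄ (u ∨₄ v) ≟ u)
  }

module _ (_⇒_ : Op₂ Four) where

  Residual? : Dec (∀ u v → u ∧₄ (u ⇒ v) ≡ u ∧₄ v)
  Residual? = ∀? λ u → ∀? λ v → u ∧₄ (u ⇒ v) ≟ u ∧₄ v

  Relative? : Dec (∀ u v w → u ∧₄ (v ⇒ w) ≡ u ∧₄ ((u ∧₄ v) ⇒ (u ∧₄ w)))
  Relative? = ∀? λ u → ∀? λ v → ∀? λ w → u ∧₄ (v ⇒ w) ≟ u ∧₄ ((u ∧₄ v) ⇒ (u ∧₄ w))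

  Reflexive? : Dec (∀ u → u ⇒ u ≡ i)
  Reflexive? = ∀? λ u → u ⇒ u ≟ i

  fourAlgebra : (∀ u v → u ∧₄ (u ⇒ v) ≡ u ∧₄ v) →
                (∀ u v w → u ∧₄ (v ⇒ w) ≡ u ∧₄ ((u ∧₄ v) ⇒ (u ∧₄ w))) →
                (∀ u → u ⇒ u ≡ i) →
                DQDAlgebra 0ℓ 0ℓ
  fourAlgebra residual relative reflexive = record
    { Carrier = Four
    ; _≈_     = _≡_
    ; _∨_     = _∨₄_
    ; _∧_     = _∧₄_
    ; _⇒_     = _⇒_
    ; _′      = _′₄
    ; 𝟎       = o
    ; 𝟏       = i
    ; isDQD   = record
      { isSemiHeyting = record
        { isLattice    = ∨₄-∧₄-isLattice
        ; ∨-identityˡ  = λ _ → refl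
        ; ∧-identityˡ  = λ _ → refl
        ; ⇒-cong       = cong₂ _⇒_
        ; ∧-⇒          = residual
        ; ∧-⇒-relative = relative
        ; ⇒-refl       = reflexive
        }
      ; ′-cong = cong _′₄
      ; 𝟎′     = refl
      ; 𝟏′     = refl
      ; ∧-′    = from-yes (∀? λ u → ∀? λ v → (u ∧₄ v) ′₄ ≟ u ′₄ ∨₄ v ′₄)
      ; ∨-′′   = from-yes (∀? λ u → ∀? λ v → (u ∨₄ v) ′₄ ′₄ ≟ u ′₄ ′₄ ∨₄ v ′₄ ′₄)
      ; ′′-≤   = from-yes (∀? λ u → u ′₄ ′₄ ∧₄ u ≟ u ′₄ ′₄)
      }
    }

𝐃₁ 𝐃₂ 𝐃₃ : DQDAlgebra 0ℓ 0ℓ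
𝐃₁ = fourAlgebra _⇒₁_ (from-yes (Residual? _⇒₁_)) (from-yes (Relative? _⇒₁_)) (from-yes (Reflexive? _⇒₁_))
𝐃₂ = fourAlgebra _⇒₂_ (from-yes (Residual? _⇒₂_)) (from-yes (Relative? _⇒₂_)) (from-yes (Reflexive? _⇒₂_))
𝐃₃ = fourAlgebra _⇒₃_ (from-yes (Residual? _⇒₃_)) (from-yes (Relative? _⇒₃_)) (from-yes (Reflexive? _⇒₃_))

{-# OPTIONS --safe #-}
module Submission where

-- The inclusion of the join in JID₁ is a computation: in a dually Stone algebra
-- every x ′ is complemented by x ′ ′, which gives both identities of JID₁
-- (module DuallyStone), and the four-element algebras are finite.
--
-- For the other inclusion, the distributivity identity makes every x ′
-- complemented, and the level 1 identity then makes ⌊ x ⌋ = x ∧ x ′ * central: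
-- its complement is ⌊ x ⌋ ′, so the algebra is a product of the quotient where x
-- is 𝟏 and the quotient where ⌊ x ⌋ is 𝟎, that is x ≤ x ′.  In an indecomposable
-- algebra, therefore, x ≈ 𝟏 or x ′ ≈ 𝟏 or x ′ ≈ x for every x (trichotomy).  If
-- x ′ ≈ x never happens the algebra is dually Stone.  If it happens, x and its
-- pseudocomplement are complementary fixed points of ′, the trichotomy applied to
-- meets and joins with them leaves no room for elements other than 𝟎, these two
-- and 𝟏 (four-elements), and the operation ⇒ is determined by 𝟎 ⇒ 𝟏
-- (⇒-complemented).  The four possible values of 𝟎 ⇒ 𝟏 give 𝐃₁, 𝐃₂ and twice 𝐃₃.
--
-- Decompositions into indecomposables need choice, so the argument is carried out
-- locally: to prove an equation it suffices to prove it in the two quotients given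
-- by a central element, and an identity only involves finitely many elements.
-- Instead of deciding whether an algebra is dually Stone, its largest dually Stone
-- quotient is formed, in which elements are identified when they agree below a
-- finite meet of the central elements stonePart z.  An identity valid there holds
-- below such a meet; on the complement of each stonePart z there are atoms, and
-- valuations of the variables factor locally through one of the 𝐃ᵢ (separation).

open import Defs
open import Algebra.Core using (Op₂)
import Algebra.Lattice.Bundles as Alg
import Algebra.Lattice.Properties.Lattice as AlgLatticeProperties
open import Data.List using (List; []; _∷_; _++_; foldr)
open import Data.List.Relation.Unary.All as All using (All; []; _∷_)
open import Data.List.Relation.Unary.Any using (here; there)
open import Data.Nat using (ℕ; zero; suc; _<_; s<s)
import Data.Nat as ℕ
open import Data.Nat.Properties using (m<n⇒m<n⊔o; m<n⇒m<o⊔n; n<1+n)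
open import Data.Product using (_,_; proj₁; proj₂; ∃)
open import Data.Sum using (_⊎_; inj₁; inj₂)
open import Function using (_∘_; id)
open import Level using (Level; Lift; lift; lower; 0ℓ; _⊔_) renaming (suc to lsuc)
open import Relation.Binary.Core using (Rel)
open import Relation.Binary.Structures using (IsEquivalence)
open import Relation.Binary.Lattice using (Lattice; HeytingAlgebra)
import Relation.Binary.Lattice.Properties.HeytingAlgebra as HeytingProperties
import Relation.Binary.Lattice.Properties.BoundedLattice as BoundedProperties
import Relation.Binary.Lattice.Properties.BoundedJoinSemilattice as BoundedJoinProperties
import Relation.Binary.Lattice.Properties.BoundedMeetSemilattice as BoundedMeetProperties
import Relation.Binary.Lattice.Properties.DistributiveLattice as DistributiveProperties
open import Relation.Binary.PropositionalEquality as ≡ using (_≡_)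
import Relation.Binary.Reasoning.Setoid as ≈-Reasoning
open import Relation.Nullary using (Dec)
open import Relation.Nullary.Decidable using (from-yes)

-- Arithmetic of DQD-algebras

module Properties {c ℓ} (𝐀 : DQDAlgebra c ℓ) where

  open DQDAlgebra 𝐀 public

  private
    lattice : Alg.Lattice c ℓ
    lattice = record { isLattice = isLattice }

    open AlgLatticeProperties lattice
      using (∧-idem; ∨-∧-isOrderTheoreticLattice)
  open Alg.Lattice lattice public using (setoid)
  open ≈-Reasoning setoid

  private
    ∧-zeroˡ′ : ∀ x → 𝟎 ∧ x ≈ 𝟎
    ∧-zeroˡ′ x = begin
      𝟎 ∧ x        ≈⟨ ∧-congˡ (∨-identityˡ x) ⟨
      𝟎 ∧ (𝟎 ∨ x)  ≈⟨ ∧-absorbs-∨ 𝟎 x ⟩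
      𝟎            ∎

  -- The lattice reduct of a semi-Heyting algebra is a Heyting algebra, with
  -- implication x ⇒ x ∧ y; in particular it is distributive.
  heytingAlgebra : HeytingAlgebra c ℓ ℓ
  heytingAlgebra = record
    { _⇨_              = λ x y → x ⇒ x ∧ y
    ; isHeytingAlgebra = record
      { isBoundedLattice = record
        { isLattice = ∨-∧-isOrderTheoreticLattice
        ; maximum   = λ x → sym (trans (∧-comm x 𝟏) (∧-identityˡ x))
        ; minimum   = λ x → sym (∧-zeroˡ′ x)
        }
      ; exponential = λ w x y → to w x y , from w x y
      }
    }
    where
    to : ∀ w x y → w ∧ x ≈ (w ∧ x) ∧ y → w ≈ w ∧ (x ⇒ x ∧ y)
    to w x y wx≤y = sym (begin
      w ∧ (x ⇒ x ∧ y)            ≈⟨ ∧-⇒-relative w x (x ∧ y) ⟩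
      w ∧ (w ∧ x ⇒ w ∧ (x ∧ y))  ≈⟨ ∧-congˡ (⇒-cong refl (∧-assoc w x y)) ⟨
      w ∧ (w ∧ x ⇒ (w ∧ x) ∧ y)  ≈⟨ ∧-congˡ (⇒-cong refl wx≤y) ⟨
      w ∧ (w ∧ x ⇒ w ∧ x)        ≈⟨ ∧-congˡ (⇒-refl (w ∧ x)) ⟩
      w ∧ 𝟏                      ≈⟨ trans (∧-comm w 𝟏) (∧-identityˡ w) ⟩
      w                          ∎)

    from : ∀ w x y → w ≈ w ∧ (x ⇒ x ∧ y) → w ∧ x ≈ (w ∧ x) ∧ y
    from w x y w≤ = sym (begin
      (w ∧ x) ∧ y                  ≈⟨ ∧-assoc w x y ⟩
      w ∧ (x ∧ y)                  ≈⟨ ∧-congʳ w≤ ⟩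
      (w ∧ r) ∧ (x ∧ y)           ≈⟨ ∧-assoc w r (x ∧ y) ⟩
      w ∧ (r ∧ (x ∧ y))           ≈⟨ ∧-congˡ lemma ⟩
      w ∧ (r ∧ x)                 ≈⟨ ∧-assoc w r x ⟨
      (w ∧ r) ∧ x                 ≈⟨ ∧-congʳ w≤ ⟨
      w ∧ x                        ∎)
      where
      r = x ⇒ x ∧ y
      r∧x : r ∧ x ≈ x ∧ y
      r∧x = begin
        r ∧ x       ≈⟨ ∧-comm r x ⟩
        x ∧ r       ≈⟨ ∧-⇒ x (x ∧ y) ⟩
        x ∧ (x ∧ y)  ≈⟨ ∧-assoc x x y ⟨
        (x ∧ x) ∧ y  ≈⟨ ∧-congʳ (∧-idem x) ⟩
        x ∧ y        ∎
      lemma : r ∧ (x ∧ y) ≈ r ∧ x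
      lemma = begin
        r ∧ (x ∧ y)   ≈⟨ ∧-assoc r x y ⟨
        (r ∧ x) ∧ y   ≈⟨ ∧-congʳ r∧x ⟩
        (x ∧ y) ∧ y    ≈⟨ ∧-assoc x y y ⟩
        x ∧ (y ∧ y)    ≈⟨ ∧-congˡ (∧-idem y) ⟩
        x ∧ y          ≈⟨ r∧x ⟨
        r ∧ x         ∎

  open HeytingAlgebra heytingAlgebra public
    using (_≤_; antisym; x≤x∨y; y≤x∨y; ∨-least; x∧y≤x; x∧y≤y; ∧-greatest;
           maximum; minimum)
    renaming (refl to ≤-refl; trans to ≤-trans; reflexive to ≤-reflexive)
  open HeytingAlgebra heytingAlgebra using (boundedLattice; boundedJoinSemilattice; boundedMeetSemilattice)
  open HeytingProperties heytingAlgebra public using (∧-distribˡ-∨)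
  open HeytingProperties heytingAlgebra using (distributiveLattice)
  open BoundedProperties boundedLattice public using (∧-zeroˡ; ∧-zeroʳ; ∨-zeroˡ; ∨-zeroʳ)
  open BoundedJoinProperties boundedJoinSemilattice public using () renaming (identityʳ to ∨-identityʳ)
  open BoundedMeetProperties boundedMeetSemilattice public using () renaming (identityʳ to ∧-identityʳ)
  open DistributiveProperties distributiveLattice using (∧-distribʳ-∨; ∨-distribˡ-∧)

  infixl 9 _*

  _* : Carrier → Carrier
  x * = x ⇒ 𝟎

  𝟎≈𝟏⇒≈ : 𝟎 ≈ 𝟏 → ∀ x y → x ≈ y
  𝟎≈𝟏⇒≈ 0≈1 x y = trans (collapse x) (sym (collapse y))
    where
    collapse : ∀ z → z ≈ 𝟎
    collapse z = begin
      z      ≈⟨ ∧-identityˡ z ⟨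
      𝟏 ∧ z  ≈⟨ ∧-congʳ 0≈1 ⟨
      𝟎 ∧ z  ≈⟨ ∧-zeroˡ z ⟩
      𝟎      ∎

  -- An equation holds as soon as it holds below each of two elements
  -- covering 𝟏.
  glue : ∀ {p q x y} → p ∨ q ≈ 𝟏 → p ∧ x ≈ p ∧ y → q ∧ x ≈ q ∧ y → x ≈ y
  glue {p} {q} {x} {y} p∨q≈1 px qx = begin
    x                  ≈⟨ ∧-identityˡ x ⟨
    𝟏 ∧ x              ≈⟨ ∧-congʳ p∨q≈1 ⟨
    (p ∨ q) ∧ x        ≈⟨ ∧-distribʳ-∨ x p q ⟩
    (p ∧ x) ∨ (q ∧ x)  ≈⟨ ∨-cong px qx ⟩
    (p ∧ y) ∨ (q ∧ y)  ≈⟨ ∧-distribʳ-∨ y p q ⟨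
    (p ∨ q) ∧ y        ≈⟨ ∧-congʳ p∨q≈1 ⟩
    𝟏 ∧ y              ≈⟨ ∧-identityˡ y ⟩
    y                  ∎

  joins≈𝟏 : ∀ {p x y} → x ∧ y ≈ 𝟎 → p ∨ x ≈ 𝟏 → p ∨ y ≈ 𝟏 → p ≈ 𝟏
  joins≈𝟏 {p} {x} {y} x∧y≈0 p∨x≈1 p∨y≈1 = begin
    p                  ≈⟨ ∨-identityʳ p ⟨
    p ∨ 𝟎              ≈⟨ ∨-congˡ x∧y≈0 ⟨
    p ∨ (x ∧ y)        ≈⟨ ∨-distribˡ-∧ p x y ⟩
    (p ∨ x) ∧ (p ∨ y)  ≈⟨ ∧-cong p∨x≈1 p∨y≈1 ⟩
    𝟏 ∧ 𝟏              ≈⟨ ∧-identityˡ 𝟏 ⟩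
    𝟏                  ∎

  -- Agreement of x and y below e, written e ∧ x ≈ e ∧ y, is a congruence of
  -- the semi-Heyting reduct for every e.

  module _ {e : Carrier} where

    below-∧ : ∀ {x y u v} → e ∧ x ≈ e ∧ y → e ∧ u ≈ e ∧ v → e ∧ (x ∧ u) ≈ e ∧ (y ∧ v)
    below-∧ {x} {y} {u} {v} p q = begin
      e ∧ (x ∧ u)  ≈⟨ ∧-assoc e x u ⟨
      (e ∧ x) ∧ u  ≈⟨ ∧-congʳ (trans p (∧-comm e y)) ⟩
      (y ∧ e) ∧ u  ≈⟨ ∧-assoc y e u ⟩
      y ∧ (e ∧ u)  ≈⟨ ∧-congˡ q ⟩
      y ∧ (e ∧ v)  ≈⟨ ∧-assoc y e v ⟨
      (y ∧ e) ∧ v  ≈⟨ ∧-congʳ (∧-comm y e) ⟩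
      (e ∧ y) ∧ v  ≈⟨ ∧-assoc e y v ⟩
      e ∧ (y ∧ v)  ∎

    below-∨ : ∀ {x y u v} → e ∧ x ≈ e ∧ y → e ∧ u ≈ e ∧ v → e ∧ (x ∨ u) ≈ e ∧ (y ∨ v)
    below-∨ {x} {y} {u} {v} p q = begin
      e ∧ (x ∨ u)        ≈⟨ ∧-distribˡ-∨ e x u ⟩
      (e ∧ x) ∨ (e ∧ u)  ≈⟨ ∨-cong p q ⟩
      (e ∧ y) ∨ (e ∧ v)  ≈⟨ ∧-distribˡ-∨ e y v ⟨
      e ∧ (y ∨ v)        ∎

    below-⇒ : ∀ {x y u v} → e ∧ x ≈ e ∧ y → e ∧ u ≈ e ∧ v → e ∧ (x ⇒ u) ≈ e ∧ (y ⇒ v)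
    below-⇒ {x} {y} {u} {v} p q = begin
      e ∧ (x ⇒ u)          ≈⟨ ∧-⇒-relative e x u ⟩
      e ∧ (e ∧ x ⇒ e ∧ u)  ≈⟨ ∧-congˡ (⇒-cong p q) ⟩
      e ∧ (e ∧ y ⇒ e ∧ v)  ≈⟨ ∧-⇒-relative e y v ⟨
      e ∧ (y ⇒ v)          ∎

    below-self : e ∧ e ≈ e ∧ 𝟏
    below-self = trans (antisym (x∧y≤x e e) (∧-greatest ≤-refl ≤-refl)) (sym (∧-identityʳ e))

    below-disjoint : ∀ {x} → e ∧ x ≈ 𝟎 → e ∧ x ≈ e ∧ 𝟎
    below-disjoint p = trans p (sym (∧-zeroʳ e))

  ∧-*-disjoint : ∀ x → x ∧ x * ≈ 𝟎
  ∧-*-disjoint x = trans (∧-⇒ x 𝟎) (∧-zeroʳ x)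

  ′-antitone : ∀ {x y} → x ≤ y → y ′ ≤ x ′
  ′-antitone {x} {y} x≤y = ≤-trans (y≤x∨y (x ′) (y ′))
    (≤-reflexive (sym (trans (′-cong x≤y) (∧-′ x y))))

  ′′≤ : ∀ x → x ′ ′ ≤ x
  ′′≤ x = sym (′′-≤ x)

  ′′′≈′ : ∀ x → x ′ ′ ′ ≈ x ′
  ′′′≈′ x = antisym (′′≤ (x ′)) (′-antitone (′′≤ x))

  -- The elements 𝟎 and 𝟏 are fixed by ′ only when they coincide.

  fixed≈𝟎 : ∀ {x} → x ′ ≈ x → x ≈ 𝟎 → 𝟎 ≈ 𝟏
  fixed≈𝟎 x′≈x x≈0 = trans (sym (trans x′≈x x≈0)) (trans (′-cong x≈0) 𝟎′)

  fixed≈𝟏 : ∀ {x} → x ′ ≈ x → x ≈ 𝟏 → 𝟎 ≈ 𝟏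
  fixed≈𝟏 x′≈x x≈1 = trans (sym 𝟏′) (trans (′-cong (sym x≈1)) (trans x′≈x x≈1))

  ′≈𝟏⇒′′≈𝟎 : ∀ {x} → x ′ ≈ 𝟏 → x ′ ′ ≈ 𝟎
  ′≈𝟏⇒′′≈𝟎 x′≈1 = trans (′-cong x′≈1) 𝟏′

  -- Under ′′ an element p with p ′ ≈ 𝟏 vanishes and a fixed point of ′ stays.
  fixed-absorbs : ∀ {x p} → x ′ ≈ x → p ′ ≈ 𝟏 → (x ∨ p) ′ ′ ≈ x
  fixed-absorbs {x} {p} x′≈x p′≈1 = begin
    (x ∨ p) ′ ′      ≈⟨ ∨-′′ x p ⟩
    x ′ ′ ∨ p ′ ′    ≈⟨ ∨-cong (trans (′-cong x′≈x) x′≈x) (′≈𝟏⇒′′≈𝟎 p′≈1) ⟩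
    x ∨ 𝟎            ≈⟨ ∨-identityʳ x ⟩
    x                ∎

  -- Central elements

  -- An element complemented by its own negation ′.  Such an e splits the
  -- algebra as a product of the quotients identifying e, respectively e ′,
  -- with 𝟏.
  record Central (e : Carrier) : Set ℓ where
    field
      disjoint : e ∧ e ′ ≈ 𝟎
      covering : e ∨ e ′ ≈ 𝟏

    involutive : e ′ ′ ≈ e
    involutive = antisym (′′≤ e) (≤-trans (≤-reflexive e≈) (x∧y≤y e (e ′ ′)))
      where
      covering′ : e ′ ∨ e ′ ′ ≈ 𝟏
      covering′ = trans (sym (∧-′ e (e ′))) (trans (′-cong disjoint) 𝟎′)
      e≈ : e ≈ e ∧ e ′ ′
      e≈ = begin
        e                          ≈⟨ ∧-identityʳ e ⟨
        e ∧ 𝟏                      ≈⟨ ∧-congˡ covering′ ⟨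
        e ∧ (e ′ ∨ e ′ ′)          ≈⟨ ∧-distribˡ-∨ e (e ′) (e ′ ′) ⟩
        (e ∧ e ′) ∨ (e ∧ e ′ ′)    ≈⟨ ∨-congʳ disjoint ⟩
        𝟎 ∨ (e ∧ e ′ ′)            ≈⟨ ∨-identityˡ _ ⟩
        e ∧ e ′ ′                  ∎

    below-′ : ∀ {x y} → e ∧ x ≈ e ∧ y → e ∧ x ′ ≈ e ∧ y ′
    below-′ {x} {y} p = trans (absorb x) (trans (∧-congˡ (′-cong p)) (sym (absorb y)))
      where
      absorb : ∀ z → e ∧ z ′ ≈ e ∧ (e ∧ z) ′
      absorb z = sym (begin
        e ∧ (e ∧ z) ′              ≈⟨ ∧-congˡ (∧-′ e z) ⟩
        e ∧ (e ′ ∨ z ′)            ≈⟨ ∧-distribˡ-∨ e (e ′) (z ′) ⟩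
        (e ∧ e ′) ∨ (e ∧ z ′)      ≈⟨ ∨-congʳ disjoint ⟩
        𝟎 ∨ (e ∧ z ′)              ≈⟨ ∨-identityˡ _ ⟩
        e ∧ z ′                    ∎)

  open Central

  Central-′ : ∀ {e} → Central e → Central (e ′)
  Central-′ {e} ce = record
    { disjoint = trans (∧-congˡ (involutive ce)) (trans (∧-comm (e ′) e) (disjoint ce))
    ; covering = trans (∨-congˡ (involutive ce)) (trans (∨-comm (e ′) e) (covering ce))
    }

  Central-𝟏 : Central 𝟏
  Central-𝟏 = record
    { disjoint = trans (∧-identityˡ _) 𝟏′
    ; covering = ∨-zeroˡ _
    }

  Central-∧ : ∀ {e f} → Central e → Central f → Central (e ∧ f)
  Central-∧ {e} {f} ce cf = record
    { disjoint = begin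
        (e ∧ f) ∧ (e ∧ f) ′                    ≈⟨ ∧-congˡ (∧-′ e f) ⟩
        (e ∧ f) ∧ (e ′ ∨ f ′)                  ≈⟨ ∧-distribˡ-∨ (e ∧ f) (e ′) (f ′) ⟩
        ((e ∧ f) ∧ e ′) ∨ ((e ∧ f) ∧ f ′)      ≈⟨ ∨-cong left right ⟩
        𝟎 ∨ 𝟎                                  ≈⟨ ∨-identityˡ 𝟎 ⟩
        𝟎                                      ∎
    ; covering = glue (covering ce)
        (begin
          e ∧ (e ∧ f ∨ (e ∧ f) ′)      ≈⟨ below-∨ (below-∧ below-self refl) (∧-congˡ (∧-′ e f)) ⟩
          e ∧ (𝟏 ∧ f ∨ (e ′ ∨ f ′))    ≈⟨ below-∨ (∧-congˡ (∧-identityˡ f)) (below-∨ (below-disjoint (disjoint ce)) refl) ⟩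
          e ∧ (f ∨ (𝟎 ∨ f ′))          ≈⟨ ∧-congˡ (∨-congˡ (∨-identityˡ _)) ⟩
          e ∧ (f ∨ f ′)                ≈⟨ ∧-congˡ (covering cf) ⟩
          e ∧ 𝟏                        ∎)
        (begin
          e ′ ∧ (e ∧ f ∨ (e ∧ f) ′)      ≈⟨ ∧-congˡ (∨-congˡ (∧-′ e f)) ⟩
          e ′ ∧ (e ∧ f ∨ (e ′ ∨ f ′))    ≈⟨ below-∨ refl (below-∨ below-self refl) ⟩
          e ′ ∧ (e ∧ f ∨ (𝟏 ∨ f ′))      ≈⟨ ∧-congˡ (trans (∨-congˡ (∨-zeroˡ _)) (∨-zeroʳ _)) ⟩
          e ′ ∧ 𝟏                        ∎)
    }
    where
    left : (e ∧ f) ∧ e ′ ≈ 𝟎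
    left = begin
      (e ∧ f) ∧ e ′  ≈⟨ ∧-congʳ (∧-comm e f) ⟩
      (f ∧ e) ∧ e ′  ≈⟨ ∧-assoc f e (e ′) ⟩
      f ∧ (e ∧ e ′)  ≈⟨ ∧-congˡ (disjoint ce) ⟩
      f ∧ 𝟎          ≈⟨ ∧-zeroʳ f ⟩
      𝟎              ∎
    right : (e ∧ f) ∧ f ′ ≈ 𝟎
    right = begin
      (e ∧ f) ∧ f ′  ≈⟨ ∧-assoc e f (f ′) ⟩
      e ∧ (f ∧ f ′)  ≈⟨ ∧-congˡ (disjoint cf) ⟩
      e ∧ 𝟎          ≈⟨ ∧-zeroʳ e ⟩
      𝟎              ∎

  -- Implication between complemented elements

  -- On complemented elements the operation ⇒ is determined by the single
  -- value 𝟎 ⇒ 𝟏.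
  ⇒-complemented : ∀ {p p̄ q q̄} → p ∨ p̄ ≈ 𝟏 → p ∧ p̄ ≈ 𝟎 → q ∨ q̄ ≈ 𝟏 → q ∧ q̄ ≈ 𝟎 →
                   p ⇒ q ≈ p ∧ q ∨ p̄ ∧ q̄ ∨ p̄ ∧ q ∧ (𝟎 ⇒ 𝟏)
  ⇒-complemented {p} {p̄} {q} {q̄} p∨p̄ p∧p̄ q∨q̄ q∧q̄ = glue p∨p̄
    (begin
      p ∧ (p ⇒ q)                         ≈⟨ ∧-⇒ p q ⟩
      p ∧ q                               ≈⟨ ∧-congˡ (∨-identityʳ q) ⟨
      p ∧ (q ∨ 𝟎)                         ≈⟨ ∧-congˡ (∨-cong (∧-identityˡ q) (trans (∨-cong (∧-zeroˡ _) (∧-zeroˡ _)) (∨-identityˡ 𝟎))) ⟨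
      p ∧ (𝟏 ∧ q ∨ 𝟎 ∧ q̄ ∨ 𝟎 ∧ q ∧ k)     ≈⟨ below-∨ (below-∧ (sym below-self) refl) (below-∨ (below-∧ (sym (below-disjoint p∧p̄)) refl) (below-∧ (sym (below-disjoint p∧p̄)) refl)) ⟩
      p ∧ (p ∧ q ∨ p̄ ∧ q̄ ∨ p̄ ∧ q ∧ k)     ∎)
    (begin
      p̄ ∧ (p ⇒ q)                         ≈⟨ below-⇒ (below-disjoint p̄∧p) refl ⟩
      p̄ ∧ (𝟎 ⇒ q)                         ≈⟨ ∧-congˡ 𝟎⇒q ⟩
      p̄ ∧ (q̄ ∨ q ∧ k)                     ≈⟨ ∧-congˡ (trans (∨-cong (∧-zeroˡ q) (∨-cong (∧-identityˡ _) (∧-identityˡ _))) (∨-identityˡ _)) ⟨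
      p̄ ∧ (𝟎 ∧ q ∨ 𝟏 ∧ q̄ ∨ 𝟏 ∧ q ∧ k)     ≈⟨ below-∨ (below-∧ (sym (below-disjoint p̄∧p)) refl) (below-∨ (below-∧ (sym below-self) refl) (below-∧ (sym below-self) refl)) ⟩
      p̄ ∧ (p ∧ q ∨ p̄ ∧ q̄ ∨ p̄ ∧ q ∧ k)     ∎)
    where
    k = 𝟎 ⇒ 𝟏
    p̄∧p = trans (∧-comm p̄ p) p∧p̄
    q̄∧q = trans (∧-comm q̄ q) q∧q̄
    𝟎⇒q : 𝟎 ⇒ q ≈ q̄ ∨ q ∧ k
    𝟎⇒q = glue q∨q̄
      (begin
        q ∧ (𝟎 ⇒ q)        ≈⟨ below-⇒ refl below-self ⟩
        q ∧ k              ≈⟨ ∧-congˡ (trans (∨-identityˡ _) (∧-identityˡ k)) ⟨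
        q ∧ (𝟎 ∨ 𝟏 ∧ k)    ≈⟨ below-∨ (sym (below-disjoint q∧q̄)) (below-∧ (sym below-self) refl) ⟩
        q ∧ (q̄ ∨ q ∧ k)    ∎)
      (begin
        q̄ ∧ (𝟎 ⇒ q)        ≈⟨ below-⇒ refl (below-disjoint q̄∧q) ⟩
        q̄ ∧ (𝟎 ⇒ 𝟎)        ≈⟨ ∧-congˡ (⇒-refl 𝟎) ⟩
        q̄ ∧ 𝟏              ≈⟨ ∧-congˡ (∨-zeroˡ _) ⟨
        q̄ ∧ (𝟏 ∨ q ∧ k)    ≈⟨ below-∨ (sym below-self) refl ⟩
        q̄ ∧ (q̄ ∨ q ∧ k)    ∎)

  -- Dually Stone algebras satisfy the axioms of JID₁

  module DuallyStone (stone : ∀ x → x ′ ∧ x ′ ′ ≈ 𝟎) where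

    ′∨′′ : ∀ x → x ′ ∨ x ′ ′ ≈ 𝟏
    ′∨′′ x = begin
      x ′ ∨ x ′ ′        ≈⟨ ∨-congʳ (′′′≈′ x) ⟨
      x ′ ′ ′ ∨ x ′ ′    ≈⟨ ∨-comm _ _ ⟩
      x ′ ′ ∨ x ′ ′ ′    ≈⟨ ∧-′ (x ′) (x ′ ′) ⟨
      (x ′ ∧ x ′ ′) ′    ≈⟨ ′-cong (stone x) ⟩
      𝟎 ′                ≈⟨ 𝟎′ ⟩
      𝟏                  ∎

    stone′ : ∀ x → x ′ ′ ∧ x ′ ≈ 𝟎
    stone′ x = trans (∧-comm _ _) (stone x)

    ∨-⇒ : ∀ x y z → x ′ ∨ (y ⇒ z) ≈ (x ′ ∨ y ⇒ x ′ ∨ z)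
    ∨-⇒ x y z = glue (′∨′′ x)
      (begin
        x ′ ∧ (x ′ ∨ (y ⇒ z))        ≈⟨ above (y ⇒ z) ⟩
        x ′ ∧ 𝟏                      ≈⟨ ∧-congˡ (⇒-refl 𝟏) ⟨
        x ′ ∧ (𝟏 ⇒ 𝟏)                ≈⟨ below-⇒ (above y) (above z) ⟨
        x ′ ∧ (x ′ ∨ y ⇒ x ′ ∨ z)    ∎)
      (begin
        x ′ ′ ∧ (x ′ ∨ (y ⇒ z))        ≈⟨ beside (y ⇒ z) ⟩
        x ′ ′ ∧ (y ⇒ z)                ≈⟨ below-⇒ (beside y) (beside z) ⟨
        x ′ ′ ∧ (x ′ ∨ y ⇒ x ′ ∨ z)    ∎)
      where
      above : ∀ w → x ′ ∧ (x ′ ∨ w) ≈ x ′ ∧ 𝟏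
      above w = trans (below-∨ below-self refl) (∧-congˡ (∨-zeroˡ w))
      beside : ∀ w → x ′ ′ ∧ (x ′ ∨ w) ≈ x ′ ′ ∧ w
      beside w = trans (below-∨ (below-disjoint (stone′ x)) refl) (∧-congˡ (∨-identityˡ w))

    ′*≈′′ : ∀ x → x ′ * ≈ x ′ ′
    ′*≈′′ x = glue (′∨′′ x)
      (trans (∧-*-disjoint (x ′)) (sym (stone x)))
      (begin
        x ′ ′ ∧ (x ′ ⇒ 𝟎)    ≈⟨ below-⇒ (below-disjoint (stone′ x)) refl ⟩
        x ′ ′ ∧ (𝟎 ⇒ 𝟎)      ≈⟨ ∧-congˡ (⇒-refl 𝟎) ⟩
        x ′ ′ ∧ 𝟏            ≈⟨ below-self ⟨
        x ′ ′ ∧ x ′ ′        ∎)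

    levelOne : ∀ x → x ∧ x ′ * ≈ (x ∧ x ′ *) ′ *
    levelOne x = trans f≈ (sym (begin
      (x ∧ x ′ *) ′ *  ≈⟨ ⇒-cong (′-cong f≈) refl ⟩
      x ′ ′ ′ *        ≈⟨ ⇒-cong (′′′≈′ x) refl ⟩
      x ′ *            ≈⟨ ′*≈′′ x ⟩
      x ′ ′            ∎))
      where
      f≈ : x ∧ x ′ * ≈ x ′ ′
      f≈ = trans (∧-congˡ (′*≈′′ x)) (trans (∧-comm x (x ′ ′)) (′′-≤ x))

  -- Consequences of the join-infinite distributivity and level 1 identities

  -- An element below x; it is central whenever the elements y ′ are complemented
  -- and the level 1 identity holds.
  ⌊_⌋ : Carrier → Carrier
  ⌊ x ⌋ = x ∧ x ′ *

  -- The instance of the distributivity identity that matters: the elements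
  -- x ′ are complemented.
  ′-complemented : 𝐀 ⊨ joinInfDistr → ∀ x → x ′ ∨ x ′ * ≈ 𝟏
  ′-complemented jid x = begin
    x ′ ∨ (x ′ ⇒ 𝟎)      ≈⟨ jid (λ { 0 → x ; 1 → x ′ ; _ → 𝟎 }) ⟩
    x ′ ∨ x ′ ⇒ x ′ ∨ 𝟎  ≈⟨ ⇒-cong (antisym (∨-least ≤-refl ≤-refl) (x≤x∨y _ _)) (∨-identityʳ _) ⟩
    x ′ ⇒ x ′            ≈⟨ ⇒-refl (x ′) ⟩
    𝟏                    ∎

  module Level1 (complemented : ∀ x → x ′ ∨ x ′ * ≈ 𝟏)
                (levelOne : ∀ x → ⌊ x ⌋ ≈ ⌊ x ⌋ ′ *) where

    ⌊⌋-central : ∀ x → Central ⌊ x ⌋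
    ⌊⌋-central x = record
      { disjoint = trans (∧-congʳ (levelOne x)) (trans (∧-comm _ _) (∧-*-disjoint _))
      ; covering = trans (∨-congʳ (levelOne x)) (trans (∨-comm _ _) (complemented _))
      }

    ⌊⌋≈𝟎⇒≤′ : ∀ x → ⌊ x ⌋ ≈ 𝟎 → x ≤ x ′
    ⌊⌋≈𝟎⇒≤′ x f≈0 = begin
      x                      ≈⟨ ∧-identityʳ x ⟨
      x ∧ 𝟏                  ≈⟨ ∧-congˡ (complemented x) ⟨
      x ∧ (x ′ ∨ x ′ *)      ≈⟨ ∧-distribˡ-∨ x (x ′) (x ′ *) ⟩
      (x ∧ x ′) ∨ ⌊ x ⌋      ≈⟨ ∨-congˡ f≈0 ⟩
      (x ∧ x ′) ∨ 𝟎          ≈⟨ ∨-identityʳ _ ⟩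
      x ∧ x ′                ∎

-- Quotients and generated subalgebras

module _ {c ℓ ℓ′ : Level} (𝐀 : DQDAlgebra c ℓ) where

  open DQDAlgebra 𝐀

  -- The quotient by a congruence _~_, with the same carrier and operations.
  quotient : (_~_ : Rel Carrier ℓ′) → IsEquivalence _~_ → (∀ {x y} → x ≈ y → x ~ y) →
             (∀ {x y u v} → x ~ y → u ~ v → (x ∨ u) ~ (y ∨ v)) →
             (∀ {x y u v} → x ~ y → u ~ v → (x ∧ u) ~ (y ∧ v)) →
             (∀ {x y u v} → x ~ y → u ~ v → (x ⇒ u) ~ (y ⇒ v)) →
             (∀ {x y} → x ~ y → (x ′) ~ (y ′)) →
             DQDAlgebra c ℓ′
  quotient _ ~-isEquivalence incl ∨-cong~ ∧-cong~ ⇒-cong~ ′-cong~ = record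
    { isDQD = record
      { isSemiHeyting = record
        { isLattice = record
          { isEquivalence = ~-isEquivalence
          ; ∨-comm        = λ x y → incl (∨-comm x y)
          ; ∨-assoc       = λ x y z → incl (∨-assoc x y z)
          ; ∨-cong        = ∨-cong~
          ; ∧-comm        = λ x y → incl (∧-comm x y)
          ; ∧-assoc       = λ x y z → incl (∧-assoc x y z)
          ; ∧-cong        = ∧-cong~
          ; absorptive    = (λ x y → incl (∨-absorbs-∧ x y)) , (λ x y → incl (∧-absorbs-∨ x y))
          }
        ; ∨-identityˡ  = λ x → incl (∨-identityˡ x)
        ; ∧-identityˡ  = λ x → incl (∧-identityˡ x)
        ; ⇒-cong       = ⇒-cong~
        ; ∧-⇒          = λ x y → incl (∧-⇒ x y)
        ; ∧-⇒-relative = λ x y z → incl (∧-⇒-relative x y z)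
        ; ⇒-refl       = λ x → incl (⇒-refl x)
        }
      ; ′-cong = ′-cong~
      ; 𝟎′     = incl 𝟎′
      ; 𝟏′     = incl 𝟏′
      ; ∧-′    = λ x y → incl (∧-′ x y)
      ; ∨-′′   = λ x y → incl (∨-′′ x y)
      ; ′′-≤   = λ x → incl (′′-≤ x)
      }
    }

-- Two algebras with the same operations give terms the same values.
module _ {c ℓ ℓ′ : Level} (𝐀 : DQDAlgebra c ℓ) where

  open DQDAlgebra 𝐀

  module _ {_~_ : Rel Carrier ℓ′} (~-isDQD : IsDQD _~_ _∨_ _∧_ _⇒_ _′ 𝟎 𝟏) where

    ⟦⟧-operations : ∀ t ρ → ⟦_⟧ (record { isDQD = ~-isDQD }) t ρ ≡ ⟦_⟧ 𝐀 t ρ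
    ⟦⟧-operations (var n)  ρ = ≡.refl
    ⟦⟧-operations (s :∨ t) ρ = ≡.cong₂ _∨_ (⟦⟧-operations s ρ) (⟦⟧-operations t ρ)
    ⟦⟧-operations (s :∧ t) ρ = ≡.cong₂ _∧_ (⟦⟧-operations s ρ) (⟦⟧-operations t ρ)
    ⟦⟧-operations (s :→ t) ρ = ≡.cong₂ _⇒_ (⟦⟧-operations s ρ) (⟦⟧-operations t ρ)
    ⟦⟧-operations (t :′)   ρ = ≡.cong _′ (⟦⟧-operations t ρ)
    ⟦⟧-operations :0       ρ = ≡.refl
    ⟦⟧-operations :1       ρ = ≡.refl

-- The subalgebra of 𝐀 generated by the values of ρ.  Its elements are terms,
-- so that it has a copy at every carrier level and every larger relation level.
module Generated {a b} (c ℓ : Level) (𝐀 : DQDAlgebra a b) (ρ : ℕ → DQDAlgebra.Carrier 𝐀) where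

  private
    module 𝐀 = DQDAlgebra 𝐀

    value : Lift c Term → 𝐀.Carrier
    value t = ⟦_⟧ 𝐀 (lower t) ρ

  generated : DQDAlgebra c (ℓ ⊔ b)
  generated = record
    { Carrier = Lift c Term
    ; _≈_     = λ s t → Lift ℓ (value s 𝐀.≈ value t)
    ; _∨_     = λ s t → lift (lower s :∨ lower t)
    ; _∧_     = λ s t → lift (lower s :∧ lower t)
    ; _⇒_     = λ s t → lift (lower s :→ lower t)
    ; _′      = λ t → lift (lower t :′)
    ; 𝟎       = lift :0
    ; 𝟏       = lift :1
    ; isDQD   = record
      { isSemiHeyting = record
        { isLattice = record
          { isEquivalence = record
            { refl  = lift 𝐀.refl
            ; sym   = λ (lift p) → lift (𝐀.sym p)
            ; trans = λ (lift p) (lift q) → lift (𝐀.trans p q)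
            }
          ; ∨-comm        = λ _ _ → lift (𝐀.∨-comm _ _)
          ; ∨-assoc       = λ _ _ _ → lift (𝐀.∨-assoc _ _ _)
          ; ∨-cong        = λ (lift p) (lift q) → lift (𝐀.∨-cong p q)
          ; ∧-comm        = λ _ _ → lift (𝐀.∧-comm _ _)
          ; ∧-assoc       = λ _ _ _ → lift (𝐀.∧-assoc _ _ _)
          ; ∧-cong        = λ (lift p) (lift q) → lift (𝐀.∧-cong p q)
          ; absorptive    = (λ _ _ → lift (𝐀.∨-absorbs-∧ _ _)) , (λ _ _ → lift (𝐀.∧-absorbs-∨ _ _))
          }
        ; ∨-identityˡ  = λ _ → lift (𝐀.∨-identityˡ _)
        ; ∧-identityˡ  = λ _ → lift (𝐀.∧-identityˡ _)
        ; ⇒-cong       = λ (lift p) (lift q) → lift (𝐀.⇒-cong p q)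
        ; ∧-⇒          = λ _ _ → lift (𝐀.∧-⇒ _ _)
        ; ∧-⇒-relative = λ _ _ _ → lift (𝐀.∧-⇒-relative _ _ _)
        ; ⇒-refl       = λ _ → lift (𝐀.⇒-refl _)
        }
      ; ′-cong = λ (lift p) → lift (𝐀.′-cong p)
      ; 𝟎′     = lift 𝐀.𝟎′
      ; 𝟏′     = lift 𝐀.𝟏′
      ; ∧-′    = λ _ _ → lift (𝐀.∧-′ _ _)
      ; ∨-′′   = λ _ _ → lift (𝐀.∨-′′ _ _)
      ; ′′-≤   = λ _ → lift (𝐀.′′-≤ _)
      }
    }

  value-⟦⟧ : ∀ t σ → value (⟦_⟧ generated t σ) ≡ ⟦_⟧ 𝐀 t (value ∘ σ)
  value-⟦⟧ (var n)  σ = ≡.refl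
  value-⟦⟧ (s :∨ t) σ = ≡.cong₂ 𝐀._∨_ (value-⟦⟧ s σ) (value-⟦⟧ t σ)
  value-⟦⟧ (s :∧ t) σ = ≡.cong₂ 𝐀._∧_ (value-⟦⟧ s σ) (value-⟦⟧ t σ)
  value-⟦⟧ (s :→ t) σ = ≡.cong₂ 𝐀._⇒_ (value-⟦⟧ s σ) (value-⟦⟧ t σ)
  value-⟦⟧ (t :′)   σ = ≡.cong 𝐀._′ (value-⟦⟧ t σ)
  value-⟦⟧ :0       σ = ≡.refl
  value-⟦⟧ :1       σ = ≡.refl

  generated-⊨ : ∀ e → 𝐀 ⊨ e → generated ⊨ e
  generated-⊨ (s :≈ t) valid σ =
    lift (≡.subst₂ 𝐀._≈_ (≡.sym (value-⟦⟧ s σ)) (≡.sym (value-⟦⟧ t σ)) (valid (value ∘ σ)))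

  -- Evaluating at the generators returns the given valuation of 𝐀.
  ⊨-generated : ∀ s t → generated ⊨ (s :≈ t) → ⟦_⟧ 𝐀 s ρ 𝐀.≈ ⟦_⟧ 𝐀 t ρ
  ⊨-generated s t valid = ≡.subst₂ 𝐀._≈_ (value-⟦⟧ s gen) (value-⟦⟧ t gen) (lower (valid gen))
    where gen = λ n → lift (var n)

open Generated using (generated; generated-⊨; ⊨-generated)

-- One more than the largest index of a variable of a term, 0 if there is none.
bound : Term → ℕ
bound (var n)  = suc n
bound (s :∨ t) = bound s ℕ.⊔ bound t
bound (s :∧ t) = bound s ℕ.⊔ bound t
bound (s :→ t) = bound s ℕ.⊔ bound t
bound (t :′)   = bound t
bound :0       = 0
bound :1       = 0

-- The four-element algebras

infixl 9 _ᶜ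

-- The lattice complement.
_ᶜ : Four → Four
o ᶜ = i
a ᶜ = b
b ᶜ = a
i ᶜ = o

∨-ᶜ : ∀ u → u ∨₄ u ᶜ ≡ i
∨-ᶜ = from-yes (∀? λ u → u ∨₄ u ᶜ ≟ i)

∧-ᶜ : ∀ u → u ∧₄ u ᶜ ≡ o
∧-ᶜ = from-yes (∀? λ u → u ∧₄ u ᶜ ≟ o)

-- The operation _⇒_ is given by its value at (0 , 1) through the formula of
-- ⇒-complemented.
Determined : Op₂ Four → Set
Determined _⇒_ = ∀ u v → u ⇒ v ≡ u ∧₄ v ∨₄ u ᶜ ∧₄ v ᶜ ∨₄ u ᶜ ∧₄ v ∧₄ (o ⇒ i)

determined? : ∀ _⇒_ → Dec (Determined _⇒_)
determined? _⇒_ = ∀? λ u → ∀? λ v → u ⇒ v ≟ u ∧₄ v ∨₄ u ᶜ ∧₄ v ᶜ ∨₄ u ᶜ ∧₄ v ∧₄ (o ⇒ i)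

JoinInfDistr? : (_⇒_ : Op₂ Four) →
                Dec (∀ u v w → u ′₄ ∨₄ (v ⇒ w) ≡ (u ′₄ ∨₄ v) ⇒ (u ′₄ ∨₄ w))
JoinInfDistr? _⇒_ = ∀? λ u → ∀? λ v → ∀? λ w → u ′₄ ∨₄ (v ⇒ w) ≟ (u ′₄ ∨₄ v) ⇒ (u ′₄ ∨₄ w)

Level1? : (_⇒_ : Op₂ Four) →
          Dec (∀ u → u ∧₄ ((u ′₄) ⇒ o) ≡ ((u ∧₄ ((u ′₄) ⇒ o)) ′₄) ⇒ o)
Level1? _⇒_ = ∀? λ u → u ∧₄ ((u ′₄) ⇒ o) ≟ ((u ∧₄ ((u ′₄) ⇒ o)) ′₄) ⇒ o

-- Local reasoning on quotients

module Local {c ℓ} (𝐀 : DQDAlgebra c ℓ) where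

  open DQDAlgebra 𝐀 using (Carrier; _∨_; _∧_; _⇒_; _′; 𝟎; 𝟏)

  -- A stage: an equality on the carrier for which the operations of 𝐀 form a
  -- DQD-algebra, with all x ′ complemented and the level 1 identity.  The
  -- quotients of 𝐀 are given in this way without changing elements.
  record Stage : Set (c ⊔ lsuc ℓ) where
    infix 4 _≈_
    field
      _≈_          : Rel Carrier ℓ
      isDQD        : IsDQD _≈_ _∨_ _∧_ _⇒_ _′ 𝟎 𝟏
      complemented : ∀ x → (x ′ ∨ (x ′ ⇒ 𝟎)) ≈ 𝟏
      levelOne     : ∀ x → (x ∧ (x ′ ⇒ 𝟎)) ≈ ((x ∧ (x ′ ⇒ 𝟎)) ′ ⇒ 𝟎)

    algebra : DQDAlgebra c ℓ
    algebra = record { isDQD = isDQD }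

  module At (M : Stage) where
    open Stage M using (complemented; levelOne; algebra)
    open Properties algebra public hiding (Carrier; _∨_; _∧_; _⇒_; _′; 𝟎; 𝟏)
    open Level1 complemented levelOne public

  infix 4 _⊑_ _⊢_≈_

  _⊢_≈_ : Stage → Carrier → Carrier → Set ℓ
  M ⊢ x ≈ y = Stage._≈_ M x y

  -- N is a further quotient of M.
  _⊑_ : Stage → Stage → Set (c ⊔ ℓ)
  M ⊑ N = ∀ {x y} → M ⊢ x ≈ y → N ⊢ x ≈ y

  -- The stage M modulo e ≈ 𝟏.
  localise : (M : Stage) → ∀ {e} → At.Central M e → Stage
  localise M {e} ce = record
    { isDQD        = DQDAlgebra.isDQD (quotient algebra (λ x y → e ∧ x ≈ e ∧ y)
                       (record { refl = refl ; sym = sym ; trans = trans })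
                       ∧-congˡ below-∨ below-∧ below-⇒ (below-′ ce))
    ; complemented = λ x → ∧-congˡ (Stage.complemented M x)
    ; levelOne     = λ x → ∧-congˡ (Stage.levelOne M x)
    }
    where
    open Stage M using (algebra)
    open At M
    open Central

  -- P holds locally at M when an equation holds at M as soon as it holds at
  -- every further quotient where P does.  For the equations that are proved
  -- this amounts to P holding on each part of a finite cover of M.
  record Locally {p} (P : Stage → Set p) (M : Stage) : Set (c ⊔ lsuc ℓ ⊔ p) where
    field
      conclude : ∀ x y → (∀ N → M ⊑ N → P N → N ⊢ x ≈ y) → M ⊢ x ≈ y

  open Locally public

  module _ {p} {P : Stage → Set p} where

    now : ∀ {M} → P M → Locally P M
    conclude (now {M} pM) x y k = k M id pM

    bind : ∀ {q} {Q : Stage → Set q} {M} →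
           Locally P M → (∀ N → M ⊑ N → P N → Locally Q N) → Locally Q M
    conclude (bind m f) x y k = conclude m x y λ N M⊑N pN →
      conclude (f N M⊑N pN) x y λ N′ N⊑N′ → k N′ (N⊑N′ ∘ M⊑N)

    trivial : ∀ {M} → M ⊢ 𝟎 ≈ 𝟏 → Locally P M
    conclude (trivial {M} 0≈1) x y k = At.𝟎≈𝟏⇒≈ M 0≈1 x y

  -- The central element ⌊ x ⌋ covers the stage by a part where x is 𝟏 and
  -- one where x ≤ x ′.
  dichotomy : ∀ M x → Locally (λ N → N ⊢ x ≈ 𝟏 ⊎ N ⊢ x ≈ x ∧ x ′) M
  conclude (dichotomy M x) p q k = glue (Central.covering c⌊x⌋)
    (k (localise M c⌊x⌋) ∧-congˡ (inj₁ (sym (begin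
      ⌊ x ⌋ ∧ 𝟏    ≈⟨ ∧-identityʳ _ ⟩
      ⌊ x ⌋        ≈⟨ x∧y≤x x _ ⟩
      ⌊ x ⌋ ∧ x    ∎))))
    (k N ∧-congˡ (inj₂ (At.⌊⌋≈𝟎⇒≤′ N x (below-disjoint (trans (∧-comm _ _) (Central.disjoint c⌊x⌋))))))
    where
    open At M
    open ≈-Reasoning setoid
    c⌊x⌋ = ⌊⌋-central x
    N = localise M (Central-′ c⌊x⌋)

  -- In an indecomposable stage every x ≠ 𝟏 satisfies x ≤ x ′; applied to x and
  -- x ′ this leaves three possibilities.
  trichotomy : ∀ M x → Locally (λ N → N ⊢ x ≈ 𝟏 ⊎ N ⊢ x ′ ≈ 𝟏 ⊎ N ⊢ x ′ ≈ x) M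
  trichotomy M x = bind (dichotomy M x) λ where
    N _ (inj₁ x≈1)  → now (inj₁ x≈1)
    N _ (inj₂ x≤x′) → bind (dichotomy N (x ′)) λ where
      N′ _    (inj₁ x′≈1)   → now (inj₂ (inj₁ x′≈1))
      N′ N⊑N′ (inj₂ x′≤x″)  → let open At N′ in
        now (inj₂ (inj₂ (antisym (≤-trans x′≤x″ (′′≤ x)) (N⊑N′ x≤x′))))

  -- Stages that are not dually Stone

  -- Complementary fixed points x and y of ′.  In a nontrivial indecomposable
  -- stage they are the two atoms of a four-element algebra.
  record Atoms (x y : Carrier) (M : Stage) : Set ℓ where
    field
      x-fixed  : M ⊢ x ′ ≈ x
      y-fixed  : M ⊢ y ′ ≈ y
      disjoint : M ⊢ x ∧ y ≈ 𝟎
      covering : M ⊢ x ∨ y ≈ 𝟏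

  Atoms-⊑ : ∀ {x y M N} → M ⊑ N → Atoms x y M → Atoms x y N
  Atoms-⊑ M⊑N at = record
    { x-fixed  = M⊑N x-fixed
    ; y-fixed  = M⊑N y-fixed
    ; disjoint = M⊑N disjoint
    ; covering = M⊑N covering
    }
    where open Atoms at

  Atoms-swap : ∀ {x y M} → Atoms x y M → Atoms y x M
  Atoms-swap {x} {y} {M} at = record
    { x-fixed  = y-fixed
    ; y-fixed  = x-fixed
    ; disjoint = trans (∧-comm y x) disjoint
    ; covering = trans (∨-comm y x) covering
    }
    where
    open Atoms at
    open At M

  -- The element ⌊ u * ⌋ for u = z ′ ∧ z ′ ′.  It is disjoint from u, so making it
  -- 𝟏 forces u to be 𝟎; conversely it is 𝟏 where u is 𝟎.
  stonePart : Carrier → Carrier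
  stonePart z = v ∧ (v ′ ⇒ 𝟎)
    where v = z ′ ∧ z ′ ′ ⇒ 𝟎

  -- Where stonePart z is 𝟎 ≉ 𝟏, neither z nor z ′ can be 𝟏, so z is a fixed point
  -- of ′, and its pseudocomplement is a complementary one.
  atoms : ∀ M z → M ⊢ stonePart z ≈ 𝟎 → Locally (Atoms z (z ⇒ 𝟎)) M
  atoms M z s≈0 = bind (trichotomy M z) λ where
      N M⊑N (inj₁ z≈1) → let open At N in
        stone N M⊑N (trans (∧-congʳ (trans (′-cong z≈1) 𝟏′)) (∧-zeroˡ _))
      N M⊑N (inj₂ (inj₁ z′≈1)) → let open At N in
        stone N M⊑N (trans (∧-congˡ (′≈𝟏⇒′′≈𝟎 z′≈1)) (∧-zeroʳ _))
      N _ (inj₂ (inj₂ z′≈z)) → bind (trichotomy N (z ⇒ 𝟎)) λ where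
        N′ N⊑N′ (inj₁ y≈1) → let open At N′ in
          trivial (fixed≈𝟎 (N⊑N′ z′≈z)
            (trans (sym (∧-identityʳ z)) (trans (∧-congˡ (sym y≈1)) (∧-*-disjoint z))))
        N′ N⊑N′ (inj₂ (inj₁ y′≈1)) → let open At N′ in
          trivial (fixed≈𝟏 (N⊑N′ z′≈z)
            (trans (sym (fixed-absorbs (N⊑N′ z′≈z) y′≈1))
            (trans (′-cong (′-cong (cover N′ (N⊑N′ z′≈z)))) (trans (′-cong 𝟏′) 𝟎′))))
        N′ N⊑N′ (inj₂ (inj₂ y′≈y)) → now (record
          { x-fixed  = N⊑N′ z′≈z
          ; y-fixed  = y′≈y
          ; disjoint = At.∧-*-disjoint N′ z
          ; covering = cover N′ (N⊑N′ z′≈z)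
          })
    where
    cover : ∀ N → N ⊢ z ′ ≈ z → N ⊢ z ∨ (z ⇒ 𝟎) ≈ 𝟏
    cover N z′≈z = trans (∨-cong (sym z′≈z) (⇒-cong (sym z′≈z) refl)) (Stage.complemented N z)
      where open At N

    -- If z ′ ∧ z ′ ′ is 𝟎 then stonePart z is 𝟏.
    stone : ∀ N → M ⊑ N → N ⊢ z ′ ∧ z ′ ′ ≈ 𝟎 → Locally (Atoms z (z ⇒ 𝟎)) N
    stone N M⊑N u≈0 = trivial (begin
      𝟎            ≈⟨ M⊑N s≈0 ⟨
      stonePart z  ≈⟨ ∧-cong v≈1 (⇒-cong (trans (′-cong v≈1) 𝟏′) refl) ⟩
      𝟏 ∧ (𝟎 ⇒ 𝟎)  ≈⟨ trans (∧-identityˡ _) (⇒-refl 𝟎) ⟩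
      𝟏            ∎)
      where
      open At N
      open ≈-Reasoning setoid
      v≈1 : N ⊢ z ′ ∧ z ′ ′ ⇒ 𝟎 ≈ 𝟏
      v≈1 = trans (⇒-cong u≈0 refl) (⇒-refl 𝟎)

  -- The sublattice 𝟎, x, y, 𝟏, with the atoms a and b of Four sent to x and y.
  embed : Carrier → Carrier → Four → Carrier
  embed x y o = 𝟎
  embed x y a = x
  embed x y b = y
  embed x y i = 𝟏

  -- The three cases for p ∧ x, whose image under ′ is p ∨ x.
  fixed-atom : ∀ {x y M p} → Atoms x y M → M ⊢ p ′ ≈ p →
               Locally (λ N → N ⊢ p ≈ x ⊎ N ⊢ p ∨ x ≈ 𝟏) M
  fixed-atom {x} {y} {M} {p} at p′≈p = bind (trichotomy M (p ∧ x)) λ where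
      N M⊑N (inj₁ px≈1) → let open At N in
        trivial (fixed≈𝟏 (M⊑N x-fixed)
          (antisym (maximum x) (≤-trans (≤-reflexive (sym px≈1)) (x∧y≤y p x))))
      N M⊑N (inj₂ (inj₁ px′≈1)) → now
        (inj₂ (At.trans N (At.sym N (px′ N M⊑N)) px′≈1))
      N M⊑N (inj₂ (inj₂ px′≈px)) → let open At N; p∨x≤p∧x = ≤-reflexive (trans (sym (px′ N M⊑N)) px′≈px) in
        now (inj₁ (antisym
          (≤-trans (x≤x∨y p x) (≤-trans p∨x≤p∧x (x∧y≤y p x)))
          (≤-trans (y≤x∨y p x) (≤-trans p∨x≤p∧x (x∧y≤x p x)))))
    where
    open Atoms at
    px′ : ∀ N → M ⊑ N → N ⊢ (p ∧ x) ′ ≈ p ∨ x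
    px′ N M⊑N = trans (∧-′ p x) (∨-cong (M⊑N p′≈p) (M⊑N x-fixed))
      where open At N

  -- Since (x ∨ p) ′ ′ is x, neither x ∨ p nor (x ∨ p) ′ can be 𝟏 ≉ 𝟎, so x ∨ p is
  -- fixed by ′ and equals x.
  below-atom : ∀ {x y M p} → Atoms x y M → M ⊢ p ′ ≈ 𝟏 → Locally (λ N → N ⊢ p ≈ p ∧ x) M
  below-atom {x} {y} {M} {p} at p′≈1 = bind (trichotomy M (x ∨ p)) λ where
      N M⊑N (inj₁ xp≈1) → let open At N in
        trivial (fixed≈𝟏 (M⊑N x-fixed)
          (trans (sym (absorbs N M⊑N)) (trans (′-cong (′-cong xp≈1)) (trans (′-cong 𝟏′) 𝟎′))))
      N M⊑N (inj₂ (inj₁ xp′≈1)) → let open At N in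
        trivial (fixed≈𝟎 (M⊑N x-fixed)
          (trans (sym (absorbs N M⊑N)) (′≈𝟏⇒′′≈𝟎 xp′≈1)))
      N M⊑N (inj₂ (inj₂ xp′≈xp)) → let open At N in
        now (≤-trans (y≤x∨y x p)
          (≤-reflexive (trans (sym (trans (′-cong xp′≈xp) xp′≈xp)) (absorbs N M⊑N))))
    where
    open Atoms at
    absorbs : ∀ N → M ⊑ N → N ⊢ (x ∨ p) ′ ′ ≈ x
    absorbs N M⊑N = At.fixed-absorbs N (M⊑N x-fixed) (M⊑N p′≈1)

  -- Atoms leave room for no elements other than 𝟎, x, y and 𝟏.
  four-elements : ∀ {x y M} → Atoms x y M → ∀ p → Locally (λ N → ∃ λ u → N ⊢ p ≈ embed x y u) M
  four-elements {x} {y} {M} at p = bind (trichotomy M p) λ where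
    N _ (inj₁ p≈1) → now (i , p≈1)
    N M⊑N (inj₂ (inj₁ p′≈1)) → let atN = Atoms-⊑ M⊑N at in
      bind (below-atom atN p′≈1) λ N₁ N⊑N₁ p≤x →
      bind (below-atom (Atoms-⊑ N⊑N₁ (Atoms-swap atN)) (N⊑N₁ p′≈1)) λ N₂ N₁⊑N₂ p≤y →
      let open At N₂ in
      now (o , antisym
        (≤-trans (∧-greatest (N₁⊑N₂ p≤x) p≤y) (≤-reflexive (N₁⊑N₂ (N⊑N₁ (Atoms.disjoint atN)))))
        (minimum p))
    N M⊑N (inj₂ (inj₂ p′≈p)) → let atN = Atoms-⊑ M⊑N at in
      bind (fixed-atom atN p′≈p) λ where
        N₁ _ (inj₁ p≈x) → now (a , p≈x)
        N₁ N⊑N₁ (inj₂ p∨x≈1) →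
          bind (fixed-atom (Atoms-⊑ N⊑N₁ (Atoms-swap atN)) (N⊑N₁ p′≈p)) λ where
            N₂ _ (inj₁ p≈y) → now (b , p≈y)
            N₂ N₁⊑N₂ (inj₂ p∨y≈1) →
              now (i , At.joins≈𝟏 N₂ (N₁⊑N₂ (N⊑N₁ (Atoms.disjoint atN))) (N₁⊑N₂ p∨x≈1) p∨y≈1)

  -- Homomorphisms from the four-element algebras

  module _ {x y N} (at : Atoms x y N) where

    open At N
    open Atoms at

    private
      h : Four → Carrier
      h = embed x y

      disjoint′ : N ⊢ y ∧ x ≈ 𝟎
      disjoint′ = trans (∧-comm y x) disjoint

      covering′ : N ⊢ y ∨ x ≈ 𝟏
      covering′ = trans (∨-comm y x) covering

      ∧-idem : ∀ p → N ⊢ p ≈ p ∧ p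
      ∧-idem p = ≤-refl

      ∨-idem : ∀ p → N ⊢ p ≈ p ∨ p
      ∨-idem p = antisym (x≤x∨y p p) (∨-least ≤-refl ≤-refl)

    embed-∨ : ∀ u v → N ⊢ h (u ∨₄ v) ≈ h u ∨ h v
    embed-∨ o v = sym (∨-identityˡ _)
    embed-∨ i v = sym (∨-zeroˡ _)
    embed-∨ a o = sym (∨-identityʳ _)
    embed-∨ a a = ∨-idem x
    embed-∨ a b = sym covering
    embed-∨ a i = sym (∨-zeroʳ _)
    embed-∨ b o = sym (∨-identityʳ _)
    embed-∨ b a = sym covering′
    embed-∨ b b = ∨-idem y
    embed-∨ b i = sym (∨-zeroʳ _)

    embed-∧ : ∀ u v → N ⊢ h (u ∧₄ v) ≈ h u ∧ h v
    embed-∧ o v = sym (∧-zeroˡ _)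
    embed-∧ i v = sym (∧-identityˡ _)
    embed-∧ a o = sym (∧-zeroʳ _)
    embed-∧ a a = ∧-idem x
    embed-∧ a b = sym disjoint
    embed-∧ a i = sym (∧-identityʳ _)
    embed-∧ b o = sym (∧-zeroʳ _)
    embed-∧ b a = sym disjoint′
    embed-∧ b b = ∧-idem y
    embed-∧ b i = sym (∧-identityʳ _)

    embed-′ : ∀ u → N ⊢ h (u ′₄) ≈ h u ′
    embed-′ o = sym 𝟎′
    embed-′ a = sym x-fixed
    embed-′ b = sym y-fixed
    embed-′ i = sym 𝟏′

    embed-ᶜ-covering : ∀ u → N ⊢ h u ∨ h (u ᶜ) ≈ 𝟏
    embed-ᶜ-covering u = trans (sym (embed-∨ u (u ᶜ))) (reflexive (≡.cong h (∨-ᶜ u)))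

    embed-ᶜ-disjoint : ∀ u → N ⊢ h u ∧ h (u ᶜ) ≈ 𝟎
    embed-ᶜ-disjoint u = trans (sym (embed-∧ u (u ᶜ))) (reflexive (≡.cong h (∧-ᶜ u)))

    module _ {_⇒₄_ : Op₂ Four} (determined : Determined _⇒₄_)
             (𝟎⇒𝟏≈ : N ⊢ 𝟎 ⇒ 𝟏 ≈ h (o ⇒₄ i)) where

      embed-⇒ : ∀ u v → N ⊢ h (u ⇒₄ v) ≈ (h u ⇒ h v)
      embed-⇒ u v = begin
        h (u ⇒₄ v)
          ≈⟨ reflexive (≡.cong h (determined u v)) ⟩
        h (u ∧₄ v ∨₄ u ᶜ ∧₄ v ᶜ ∨₄ u ᶜ ∧₄ v ∧₄ (o ⇒₄ i))
          ≈⟨ trans (embed-∨ (u ∧₄ v) _) (∨-cong (embed-∧ u v)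
               (trans (embed-∨ (u ᶜ ∧₄ v ᶜ) _) (∨-cong (embed-∧ (u ᶜ) (v ᶜ))
                 (trans (embed-∧ (u ᶜ) _) (∧-congˡ (trans (embed-∧ v _) (∧-congˡ (sym 𝟎⇒𝟏≈)))))))) ⟩
        h u ∧ h v ∨ h (u ᶜ) ∧ h (v ᶜ) ∨ h (u ᶜ) ∧ h v ∧ (𝟎 ⇒ 𝟏)
          ≈⟨ ⇒-complemented (embed-ᶜ-covering u) (embed-ᶜ-disjoint u) (embed-ᶜ-covering v) (embed-ᶜ-disjoint v) ⟨
        (h u ⇒ h v)  ∎
        where open ≈-Reasoning setoid

      module _
        {residual : ∀ u v → u ∧₄ (u ⇒₄ v) ≡ u ∧₄ v}
        {relative : ∀ u v w → u ∧₄ (v ⇒₄ w) ≡ u ∧₄ ((u ∧₄ v) ⇒₄ (u ∧₄ w))}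
        {reflexive₄ : ∀ u → u ⇒₄ u ≡ i}
        (ρ : ℕ → Carrier) (σ : ℕ → Four) where

        private
          ⟦_⟧₄ : Term → Four
          ⟦ t ⟧₄ = ⟦_⟧ (fourAlgebra _⇒₄_ residual relative reflexive₄) t σ

        embed-⟦⟧ : ∀ t → (∀ {m} → m < bound t → N ⊢ ρ m ≈ h (σ m)) →
                   N ⊢ ⟦_⟧ 𝐀 t ρ ≈ h ⟦ t ⟧₄
        embed-⟦⟧ (var n)  ρ≈σ = ρ≈σ (n<1+n n)
        embed-⟦⟧ (s :∨ t) ρ≈σ = trans
          (∨-cong (embed-⟦⟧ s (ρ≈σ ∘ m<n⇒m<n⊔o (bound t))) (embed-⟦⟧ t (ρ≈σ ∘ m<n⇒m<o⊔n (bound s))))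
          (sym (embed-∨ ⟦ s ⟧₄ ⟦ t ⟧₄))
        embed-⟦⟧ (s :∧ t) ρ≈σ = trans
          (∧-cong (embed-⟦⟧ s (ρ≈σ ∘ m<n⇒m<n⊔o (bound t))) (embed-⟦⟧ t (ρ≈σ ∘ m<n⇒m<o⊔n (bound s))))
          (sym (embed-∧ ⟦ s ⟧₄ ⟦ t ⟧₄))
        embed-⟦⟧ (s :→ t) ρ≈σ = trans
          (⇒-cong (embed-⟦⟧ s (ρ≈σ ∘ m<n⇒m<n⊔o (bound t))) (embed-⟦⟧ t (ρ≈σ ∘ m<n⇒m<o⊔n (bound s))))
          (sym (embed-⇒ ⟦ s ⟧₄ ⟦ t ⟧₄))
        embed-⟦⟧ (t :′)   ρ≈σ = trans (′-cong (embed-⟦⟧ t ρ≈σ)) (sym (embed-′ ⟦ t ⟧₄))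
        embed-⟦⟧ :0       ρ≈σ = refl
        embed-⟦⟧ :1       ρ≈σ = refl

  -- Locally, finitely many elements are all among the four.
  valuation : ∀ {x y M} → Atoms x y M → ∀ ρ n →
              Locally (λ N → ∃ λ (σ : ℕ → Four) → ∀ {m} → m < n → N ⊢ ρ m ≈ embed x y (σ m)) M
  valuation at ρ zero    = now ((λ _ → o) , λ ())
  valuation at ρ (suc n) = bind (four-elements at (ρ 0)) λ N M⊑N (u , ρ0≈u) →
    bind (valuation (Atoms-⊑ M⊑N at) (ρ ∘ suc) n) λ N′ N⊑N′ (σ , ρ≈σ) →
    now ((λ { zero → u ; (suc m) → σ m })
        , λ { {zero} _ → N⊑N′ ρ0≈u ; {suc m} (s<s m<n) → ρ≈σ m<n })

  module _ {s t : Term} where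

    atoms-⊨ : ∀ {x y M _⇒₄_ residual relative reflexive₄} → Determined _⇒₄_ → Atoms x y M →
              M ⊢ 𝟎 ⇒ 𝟏 ≈ embed x y (o ⇒₄ i) →
              fourAlgebra _⇒₄_ residual relative reflexive₄ ⊨ (s :≈ t) →
              ∀ ρ → M ⊢ ⟦_⟧ 𝐀 s ρ ≈ ⟦_⟧ 𝐀 t ρ
    atoms-⊨ {x} {y} {M} determined at 𝟎⇒𝟏≈ valid ρ =
      conclude (valuation at ρ (bound s ℕ.⊔ bound t)) _ _ λ N M⊑N (σ , ρ≈σ) →
      let open At N; atN = Atoms-⊑ {M = M} {N} M⊑N at in
      trans (embed-⟦⟧ atN determined (M⊑N 𝟎⇒𝟏≈) ρ σ s (ρ≈σ ∘ m<n⇒m<n⊔o (bound t)))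
      (trans (reflexive (≡.cong (embed x y) (valid σ)))
      (sym (embed-⟦⟧ atN determined (M⊑N 𝟎⇒𝟏≈) ρ σ t (ρ≈σ ∘ m<n⇒m<o⊔n (bound s)))))

    -- The value of 𝟎 ⇒ 𝟏 selects the four-element algebra; the values x and y
    -- both select 𝐃₃, after exchanging the atoms in the second case.
    atoms-valid : 𝐃₁ ⊨ (s :≈ t) → 𝐃₂ ⊨ (s :≈ t) → 𝐃₃ ⊨ (s :≈ t) →
                  ∀ {x y M} → Atoms x y M → ∀ ρ → M ⊢ ⟦_⟧ 𝐀 s ρ ≈ ⟦_⟧ 𝐀 t ρ
    atoms-valid v₁ v₂ v₃ at ρ = conclude (four-elements at (𝟎 ⇒ 𝟏)) _ _ λ where
      N M⊑N (o , k≈) → atoms-⊨ {M = N} (from-yes (determined? _⇒₁_)) (Atoms-⊑ M⊑N at) k≈ v₁ ρ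
      N M⊑N (i , k≈) → atoms-⊨ {M = N} (from-yes (determined? _⇒₂_)) (Atoms-⊑ M⊑N at) k≈ v₂ ρ
      N M⊑N (a , k≈) → atoms-⊨ {M = N} (from-yes (determined? _⇒₃_)) (Atoms-⊑ M⊑N at) k≈ v₃ ρ
      N M⊑N (b , k≈) → atoms-⊨ {M = N} (from-yes (determined? _⇒₃_)) (Atoms-swap (Atoms-⊑ M⊑N at)) k≈ v₃ ρ

  -- The largest dually Stone quotient

  -- The part of a stage where z ′ ∧ z ′ ′ is 𝟎 for every z in a list.
  stoneParts : List Carrier → Carrier
  stoneParts = foldr (λ z e → stonePart z ∧ e) 𝟏

  module StoneQuotient (M : Stage) where

    open At M
    open ≈-Reasoning setoid

    stoneParts-central : ∀ zs → Central (stoneParts zs)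
    stoneParts-central []       = Central-𝟏
    stoneParts-central (z ∷ zs) = Central-∧ (⌊⌋-central _) (stoneParts-central zs)

    stoneParts-++ : ∀ xs ys → M ⊢ stoneParts (xs ++ ys) ≈ stoneParts xs ∧ stoneParts ys
    stoneParts-++ []       ys = sym (∧-identityˡ _)
    stoneParts-++ (x ∷ xs) ys = trans (∧-congˡ (stoneParts-++ xs ys)) (sym (∧-assoc _ _ _))

    infix 4 _~_

    -- The congruence generated by identifying each z ′ ∧ z ′ ′ with 𝟎.
    _~_ : Rel Carrier (c ⊔ ℓ)
    x ~ y = ∃ λ zs → M ⊢ stoneParts zs ∧ x ≈ stoneParts zs ∧ y

    -- Two congruent pairs agree below a common element.
    common : ∀ {x y u v w t} →
             (∀ {e} → Central e → M ⊢ e ∧ x ≈ e ∧ y → M ⊢ e ∧ u ≈ e ∧ v → M ⊢ e ∧ w ≈ e ∧ t) →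
             x ~ y → u ~ v → w ~ t
    common {x} {y} {u} {v} f (xs , p) (ys , q) =
      xs ++ ys , f (stoneParts-central (xs ++ ys)) (restrict ≤ˡ p) (restrict ≤ʳ q)
      where
      ≤ˡ : stoneParts (xs ++ ys) ≤ stoneParts xs
      ≤ˡ = ≤-trans (≤-reflexive (stoneParts-++ xs ys)) (x∧y≤x _ _)
      ≤ʳ : stoneParts (xs ++ ys) ≤ stoneParts ys
      ≤ʳ = ≤-trans (≤-reflexive (stoneParts-++ xs ys)) (x∧y≤y _ _)
      restrict : ∀ {e f r s} → e ≤ f → M ⊢ f ∧ r ≈ f ∧ s → M ⊢ e ∧ r ≈ e ∧ s
      restrict {e} {f} {r} {s} e≤f eq = begin
        e ∧ r        ≈⟨ ∧-congʳ e≤f ⟩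
        (e ∧ f) ∧ r  ≈⟨ ∧-assoc e f r ⟩
        e ∧ (f ∧ r)  ≈⟨ ∧-congˡ eq ⟩
        e ∧ (f ∧ s)  ≈⟨ ∧-assoc e f s ⟨
        (e ∧ f) ∧ s  ≈⟨ ∧-congʳ e≤f ⟨
        e ∧ s        ∎

    ~-isDQD : IsDQD _~_ _∨_ _∧_ _⇒_ _′ 𝟎 𝟏
    ~-isDQD = DQDAlgebra.isDQD (quotient (Stage.algebra M) _~_
      (record
        { refl  = [] , refl
        ; sym   = λ (zs , p) → zs , sym p
        ; trans = common λ _ → trans
        })
      (λ p → [] , ∧-congˡ p)
      (common λ _ → below-∨)
      (common λ _ → below-∧)
      (common λ _ → below-⇒)
      (λ (zs , p) → zs , Central.below-′ (stoneParts-central zs) p))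

    stoneQuotient : DQDAlgebra c (c ⊔ ℓ)
    stoneQuotient = record { isDQD = ~-isDQD }

    stoneQuotient-dualStone : stoneQuotient ⊨ dualStone
    stoneQuotient-dualStone ρ = z ∷ [] , (begin
      (⌊ u * ⌋ ∧ 𝟏) ∧ u      ≈⟨ ∧-congʳ (∧-identityʳ _) ⟩
      ⌊ u * ⌋ ∧ u            ≈⟨ ∧-congʳ (∧-comm (u *) _) ⟩
      (r ∧ u *) ∧ u          ≈⟨ ∧-assoc r (u *) u ⟩
      r ∧ (u * ∧ u)          ≈⟨ ∧-congˡ (trans (∧-comm (u *) u) (∧-*-disjoint u)) ⟩
      r ∧ 𝟎                  ≈⟨ ∧-zeroʳ r ⟩
      𝟎                      ≈⟨ ∧-zeroʳ _ ⟨
      (⌊ u * ⌋ ∧ 𝟏) ∧ 𝟎      ∎)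
      where
      z = ρ 0
      u = z ′ ∧ z ′ ′
      r = u * ′ *

  open StoneQuotient using (stoneQuotient; stoneQuotient-dualStone)

  -- Outside the dually Stone part every stage is covered by stages with atoms,
  -- so these and the dually Stone quotient together separate elements.
  separation : ∀ {p q} → (∀ {x y N} → Atoms x y N → N ⊢ p ≈ q) →
               ∀ zs M → M ⊢ stoneParts zs ∧ p ≈ stoneParts zs ∧ q → M ⊢ p ≈ q
  separation {p} {q} p≈q [] M eq = trans (sym (∧-identityˡ p)) (trans eq (∧-identityˡ q))
    where open At M
  separation {p} {q} p≈q (z ∷ zs) M eq = glue (Central.covering cz)
    (separation p≈q zs (localise M cz)
      (trans (sym (∧-assoc _ _ _)) (trans eq (∧-assoc _ _ _))))
    (conclude (atoms (localise M (Central-′ cz)) z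
        (below-disjoint (trans (∧-comm _ _) (Central.disjoint cz))))
      p q λ _ _ → p≈q)
    where
    open At M
    cz = ⌊⌋-central (z ′ ∧ z ′ ′ ⇒ 𝟎)

  module _ (jid : 𝐀 ⊨ joinInfDistr) (lev : 𝐀 ⊨ level1) where

    -- 𝐀 itself as a stage.
    whole : Stage
    whole = record
      { isDQD        = DQDAlgebra.isDQD 𝐀
      ; complemented = Properties.′-complemented 𝐀 jid
      ; levelOne     = λ x → lev λ _ → x
      }

    valid : ∀ s t → stoneQuotient whole ⊨ (s :≈ t) →
            All (_⊨ (s :≈ t)) (𝐃₁ ∷ 𝐃₂ ∷ 𝐃₃ ∷ []) → 𝐀 ⊨ (s :≈ t)
    valid s t v (v₁ ∷ v₂ ∷ v₃ ∷ []) ρ =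
      separation (λ at → atoms-valid {s} {t} v₁ v₂ v₃ at ρ) (proj₁ s~t) whole (proj₂ s~t)
      where
      open StoneQuotient whole using (_~_; ~-isDQD)
      s~t : ⟦_⟧ 𝐀 s ρ ~ ⟦_⟧ 𝐀 t ρ
      s~t = ≡.subst₂ _~_ (⟦⟧-operations 𝐀 ~-isDQD s ρ) (⟦⟧-operations 𝐀 ~-isDQD t ρ) (v ρ)

-- The join of DSt and V (𝐃₁ , 𝐃₂ , 𝐃₃)

module _ {c ℓ : Level} where

  DSt⊨JID₁ : ∀ e → axioms (JID₁ {c} {ℓ}) e → Th (DSt {c} {ℓ}) e
  DSt⊨JID₁ _ e∈ 𝐀 𝐀∈DSt = go e∈
    where
    open Properties.DuallyStone 𝐀 (λ x → 𝐀∈DSt dualStone (lift (here ≡.refl)) λ _ → x)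
    go : ∀ {e} → axioms (JID₁ {c} {ℓ}) e → 𝐀 ⊨ e
    go (inj₁ (lift (here ≡.refl))) ρ = ∨-⇒ (ρ 0) (ρ 1) (ρ 2)
    go (inj₂ (lift (here ≡.refl))) ρ = levelOne (ρ 0)

  Dᵢ⊨JID₁ : ∀ e → axioms (JID₁ {c} {ℓ}) e → All (_⊨ e) (𝐃₁ ∷ 𝐃₂ ∷ 𝐃₃ ∷ [])
  Dᵢ⊨JID₁ _ (inj₁ (lift (here ≡.refl))) =
      (λ ρ → from-yes (JoinInfDistr? _⇒₁_) (ρ 0) (ρ 1) (ρ 2))
    ∷ (λ ρ → from-yes (JoinInfDistr? _⇒₂_) (ρ 0) (ρ 1) (ρ 2))
    ∷ (λ ρ → from-yes (JoinInfDistr? _⇒₃_) (ρ 0) (ρ 1) (ρ 2))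
    ∷ []
  Dᵢ⊨JID₁ _ (inj₂ (lift (here ≡.refl))) =
      (λ ρ → from-yes (Level1? _⇒₁_) (ρ 0))
    ∷ (λ ρ → from-yes (Level1? _⇒₂_) (ρ 0))
    ∷ (λ ρ → from-yes (Level1? _⇒₃_) (ρ 0))
    ∷ []

  -- An identity of a subvariety 𝒱 holds in every algebra of smaller levels
  -- that satisfies the axioms of 𝒱: the algebra is a union of the generated
  -- subalgebras, which have copies at the levels of 𝒱.
  Th-smaller : ∀ {c₀ ℓ₀} (𝒱 : Subvariety (c₀ ⊔ c) (ℓ₀ ⊔ ℓ)) s t → Th 𝒱 (s :≈ t) →
               (𝐀 : DQDAlgebra c₀ ℓ₀) → 𝐀 ∈ᵛ 𝒱 → 𝐀 ⊨ (s :≈ t)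
  Th-smaller {c₀} 𝒱 s t th 𝐀 𝐀∈𝒱 ρ = ⊨-generated (c₀ ⊔ c) ℓ 𝐀 ρ s t
    (th (generated (c₀ ⊔ c) ℓ 𝐀 ρ) λ e e∈ → generated-⊨ (c₀ ⊔ c) ℓ 𝐀 ρ e (𝐀∈𝒱 e e∈))

  -- The generators live at level 0, hence at smaller levels.
  Th-V : ∀ 𝐁s s t → Th (V {c} {ℓ} 𝐁s) (s :≈ t) → All (_⊨ (s :≈ t)) 𝐁s
  Th-V 𝐁s s t th = All.map (λ {𝐁} → Th-smaller (V 𝐁s) s t th 𝐁) (V-contains {c} {ℓ} 𝐁s)

  -- The dually Stone quotient has an existential over the carrier in its
  -- equality.  It is taken of a generated subalgebra with carrier at level 0,
  -- so that it lives at the level ℓ.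
  join⊨JID₁ : ∀ s t → Th (DSt {c} {ℓ}) (s :≈ t) → Th (V {c} {ℓ} (𝐃₁ ∷ 𝐃₂ ∷ 𝐃₃ ∷ [])) (s :≈ t) →
              Th (JID₁ {c} {ℓ}) (s :≈ t)
  join⊨JID₁ s t thDSt thV 𝐀 𝐀∈JID₁ ρ = ⊨-generated 0ℓ 0ℓ 𝐀 ρ s t
    (valid jid lev s t
      (Th-smaller DSt s t thDSt (stoneQuotient (whole jid lev))
        λ { _ (lift (here ≡.refl)) → stoneQuotient-dualStone (whole jid lev) })
      (Th-V (𝐃₁ ∷ 𝐃₂ ∷ 𝐃₃ ∷ []) s t thV))
    where
    𝐓 = generated 0ℓ 0ℓ 𝐀 ρ
    open Local 𝐓
    open StoneQuotient using (stoneQuotient; stoneQuotient-dualStone)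
    jid : 𝐓 ⊨ joinInfDistr
    jid = generated-⊨ 0ℓ 0ℓ 𝐀 ρ joinInfDistr (𝐀∈JID₁ _ (inj₁ (lift (here ≡.refl))))
    lev : 𝐓 ⊨ level1
    lev = generated-⊨ 0ℓ 0ℓ 𝐀 ρ level1 (𝐀∈JID₁ _ (inj₂ (lift (here ≡.refl))))

corollary5p10 : ∀ c ℓ → let open Lattice (subvarieties c ℓ) in
    JID₁ ≈ DSt ∨ V (𝐃₁ ∷ 𝐃₂ ∷ 𝐃₃ ∷ [])
corollary5p10 c ℓ =
    (λ { 𝐀 𝐀∈JID₁ (s :≈ t) (thDSt , thV) → join⊨JID₁ s t thDSt thV 𝐀 𝐀∈JID₁ })
  , (λ 𝐀 𝐀∈join e e∈ → 𝐀∈join e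
      (DSt⊨JID₁ {c} {ℓ} e e∈ , λ 𝐁 𝐁∈V → 𝐁∈V e (lift (Dᵢ⊨JID₁ {c} {ℓ} e e∈))))
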